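{- Let $\mathcal X=([v],\{R_i\}_{i=0}^d)$ be a symmetric association scheme. Let $k$ be a positive integer and let $A$ be a $v\times v$ complex diagonalisable matrix such that (1) $D_A(k)=\{a,b,c\}$ where $|D_A(k)|=3$; (2) for each $i\in\{0,1\}$ there is a constant $c_i$ with $c_A(\alpha,k)=c_i$ for all $\alpha\in\binom{[v]}{i}$, and for each $j\in\{1,\dots,d\}$ there is a constant $c_2(j)$ with $c_A(\alpha,k)=c_2(j)$ for all $\alpha\in\tilde R_j$; and (3) the hypergraph $\mathfrak H_A(v,k,c)$ is a $\operatorname{PBIBD}(v,k;\eta_2(1),\dots,\eta_2(d))$ on $\mathcal X$. Then the hypergraph $\mathfrak H_A(v,k,a)$ is a $\operatorname{PBIBD}(v,k;\lambda_1,\dots,\lambda_d)$ on $\mathcal X$ where, for each $j\in\{1,\dots,d\}$, $$\lambda_j=\frac{(-1)^k}{a-b}\bigl(c_0-2c_1+c_2(j)\bigr)-\frac{b}{a-b}\binom{v-2}{k-2}-\frac{c-b}{a-b}\,\eta_2(j).$$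
   Context: $[v]=\{1,\dots,v\}$; $\binom{[v]}{k}$ is the set of $k$-subsets of $[v]$. For a $v\times v$ matrix $A$ and $\alpha\subset[v]$, $A[\alpha]$ is the principal submatrix indexed by $\alpha$ and $\overline\alpha=[v]\setminus\alpha$. $D_A(k)=\{\det(A[\alpha]):\alpha\in\binom{[v]}{k}\}$. $c_A(\alpha,k)$ is the coefficient of $x^{v-k-|\alpha|}$ in $\det(xI-A[\overline\alpha])$. $\mathfrak H_A(v,k,a)$ is the $k$-uniform hypergraph on $[v]$ whose hyperedges are the $k$-subsets $\alpha$ with $\det(A[\alpha])=a$. A symmetric association scheme with $d\ge1$ classes on a finite set $\mathfrak X$ is $(\mathfrak X,\{R_i\}_{i=0}^d)$, with $R_i$ nonempty subsets of $\mathfrak X\times\mathfrak X$ whose $\{0,1\}$ adjacency matrices $A_i$ (with $(A_i)_{xy}=1$ iff $(x,y)\in R_i$) satisfy: $A_0=I$; $\sum_{i=0}^dA_i=J$ (all-ones); $A_i^{\top}=A_i$ for all $i$; and every product $A_iA_j$ lies in the linear span of $A_0,\dots,A_d$. Write $\tilde R_i=\{\{x,y\}:(x,y)\in R_i\}$. A $\operatorname{PBIBD}(v,k;\lambda_1,\dots,\lambda_d)$ (partially balanced incomplete block design) on this scheme, $|\mathfrak X|=v$, is a $k$-uniform hypergraph $(\mathfrak X,\mathfrak B)$ that is a $1$-design (every vertex lies in the same positive number of hyperedges) and such that for each $i\in\{1,\dots,d\}$ and each $(x,y)\in R_i$, the pair $\{x,y\}$ is contained in exactly $\lambda_i$ hyperedges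 ($\lambda_i\geq0$). -}

module Defs where

open import Algebra.Bundles.Raw using (RawRing)
open import Data.Bool.Base using (Bool; if_then_else_; T)
open import Data.Fin.Base using (Fin; zero; suc; toℕ; punchIn)
import Data.Fin.Properties as Fin
open import Data.Fin.Subset using (Subset; inside; outside; ∣_∣; ∁; ⁅_⁆; _∪_) renaming (_∈_ to _∈ₛ_)
import Data.Integer.Base as ℤ
open import Data.List.Base using (List; []; _∷_; length; map)
open import Data.List.Membership.Propositional using (_∈_)
open import Data.List.Relation.Unary.Unique.Propositional using (Unique)
import Data.Nat.Base as ℕ
import Data.Nat.Properties as ℕ
open import Data.Nat.Base using (ℕ; zero; suc)
open import Data.Nat.Combinatorics using (_C_)
open import Data.Product.Base using (∃; ∃-syntax; _×_; _,_; proj₁)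
open import Data.Rational.Base as ℚ using (ℚ; 0ℚ; 1ℚ; ½)
import Data.Rational.Properties as ℚ
open import Data.Rational.Solver using (module +-*-Solver)
open import Data.Vec.Base using ([]; _∷_)
open import Function.Bundles using (_⇔_)
open import Level using (0ℓ; _⊔_)
open import Relation.Binary.PropositionalEquality
  using (_≡_; _≢_; refl; sym; trans; cong; cong₂; subst; subst₂)
open import Relation.Nullary using (yes; no; does; contradiction)
open import Relation.Unary using (Pred)

------------------------------------------------------------------------
-- Matrices and polynomials over a ring

Matrix : ∀ {a} → Set a → ℕ → ℕ → Set a
Matrix A m n = Fin m → Fin n → A

module LinearAlgebra {c ℓ} (R : RawRing c ℓ) where

  private
    module R = RawRing R
    open R using (Carrier; 0#; 1#)

  open import Algebra.Definitions.RawSemiring R.rawSemiring using (sum; _^_)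

  I : ∀ n → Matrix Carrier n n
  I n i j = if does (i Fin.≟ j) then 1# else 0#

  infixl 7 _·_
  _·_ : ∀ {l m n} → Matrix Carrier l m → Matrix Carrier m n → Matrix Carrier l n
  (A · B) i j = sum λ h → A i h R.* B h j

  infix 4 _≋_
  _≋_ : ∀ {m n} → Matrix Carrier m n → Matrix Carrier m n → Set ℓ
  A ≋ B = ∀ i j → A i j R.≈ B i j

  Diagonal : ∀ {n} → Matrix Carrier n n → Set ℓ
  Diagonal D = ∀ i j → i ≢ j → D i j R.≈ 0#

  Diagonalisable : ∀ {n} → Matrix Carrier n n → Set (c ⊔ ℓ)
  Diagonalisable {n} A = ∃[ P ] ∃[ P⁻¹ ] ∃[ D ]
    P · P⁻¹ ≋ I n × P⁻¹ · P ≋ I n × Diagonal D × A ≋ P · D · P⁻¹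

  -- Laplace expansion along the first row.
  det : ∀ {n} → Matrix Carrier n n → Carrier
  det {zero}  A = 1#
  det {suc n} A = sum λ j →
    (R.- 1#) ^ toℕ j R.* A zero j R.* det (λ r s → A (suc r) (punchIn j s))

-- A polynomial is the list of its coefficients, constant term first; trailing
-- zeros are allowed, hence the coefficientwise equality.

module Polynomials {c ℓ} (R : RawRing c ℓ) where

  private
    module R = RawRing R
    open R using (Carrier; 0#; 1#)

  Poly : Set c
  Poly = List Carrier

  coeff : ℕ → Poly → Carrier
  coeff _       []      = 0#
  coeff zero    (a ∷ _) = a
  coeff (suc n) (_ ∷ p) = coeff n p

  coeffℤ : ℤ.ℤ → Poly → Carrier
  coeffℤ (ℤ.+ n)    p = coeff n p
  coeffℤ ℤ.-[1+ _ ] p = 0#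

  infixl 6 _⊕_
  infixl 7 _⊛_

  _⊕_ : Poly → Poly → Poly
  []      ⊕ q       = q
  (a ∷ p) ⊕ []      = a ∷ p
  (a ∷ p) ⊕ (b ∷ q) = (a R.+ b) ∷ (p ⊕ q)

  _⊛_ : Poly → Poly → Poly
  []      ⊛ q = []
  (a ∷ p) ⊛ q = map (a R.*_) q ⊕ (0# ∷ (p ⊛ q))

  Poly-rawRing : RawRing c ℓ
  Poly-rawRing = record
    { Carrier = Poly
    ; _≈_     = λ p q → ∀ n → coeff n p R.≈ coeff n q
    ; _+_     = _⊕_
    ; _*_     = _⊛_
    ; -_      = map (R.-_)
    ; 0#      = []
    ; 1#      = 1# ∷ []
    }

  X : Poly
  X = 0# ∷ 1# ∷ []

  const : Carrier → Poly
  const a = a ∷ []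

  private
    module P = RawRing Poly-rawRing
  open LinearAlgebra Poly-rawRing using (det; I)

  charPoly : ∀ {n} → Matrix Carrier n n → Poly
  charPoly {n} A = det (λ i j → (X P.* I n i j) P.+ (P.- const (A i j)))

------------------------------------------------------------------------
-- Real numbers, as Cauchy sequences of rationals

module Real where

  -- The convention recip 0 = 0 makes recip total. In the inverse of a positive
  -- real, all but finitely many terms are reciprocals of positive rationals.
  recip : ℚ → ℚ
  recip q with q ℚ.≟ 0ℚ
  ... | yes _   = 0ℚ
  ... | no  q≢0 = ℚ.1/_ q {{ℚ.≢-nonZero q≢0}}

  Cauchy : (ℕ → ℚ) → Set
  Cauchy s = ∀ ε → 0ℚ ℚ.< ε → ∃[ N ] ∀ m n → N ℕ.≤ m → N ℕ.≤ n → ℚ.∣ s m ℚ.- s n ∣ ℚ.< ε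

  record ℝ : Set where
    constructor mkℝ
    field
      seq    : ℕ → ℚ
      cauchy : Cauchy seq

  open ℝ public

  infix 4 _≃_
  _≃_ : ℝ → ℝ → Set
  x ≃ y = ∀ ε → 0ℚ ℚ.< ε → ∃[ N ] ∀ n → N ℕ.≤ n → ℚ.∣ seq x n ℚ.- seq y n ∣ ℚ.< ε

  Positive : ℝ → Set
  Positive x = ∃[ δ ] 0ℚ ℚ.< δ × ∃[ N ] ∀ n → N ℕ.≤ n → δ ℚ.≤ seq x n

  fromℚ : ℚ → ℝ
  fromℚ q = mkℝ (λ _ → q) λ ε 0<ε → 0 , λ _ _ _ _ → subst (ℚ._< ε) (sym (cong ℚ.∣_∣ (ℚ.+-inverseʳ q))) 0<ε

  open +-*-Solver

  -- Abstract, since unfolding these proofs during conversion checking is costly.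
  abstract

    ½* : ∀ {ε} → 0ℚ ℚ.< ε → 0ℚ ℚ.< ½ ℚ.* ε
    ½* {ε} 0<ε = subst (ℚ._< ½ ℚ.* ε) (ℚ.*-zeroʳ ½) (ℚ.*-monoʳ-<-pos ½ 0<ε)

    halves : ∀ ε → ½ ℚ.* ε ℚ.+ ½ ℚ.* ε ≡ ε
    halves ε = trans (sym (ℚ.*-distribʳ-+ ε ½ ½)) (ℚ.*-identityˡ ε)

    +-cauchy : ∀ x y → Cauchy (λ n → seq x n ℚ.+ seq y n)
    +-cauchy x y ε 0<ε with cauchy x (½ ℚ.* ε) (½* 0<ε) | cauchy y (½ ℚ.* ε) (½* 0<ε)
    ... | M , f | N , g = M ℕ.⊔ N , λ m n p q →
      let xm = seq x m ; xn = seq x n ; ym = seq y m ; yn = seq y n in begin-strict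
      ℚ.∣ (xm ℚ.+ ym) ℚ.- (xn ℚ.+ yn) ∣
        ≡⟨ cong ℚ.∣_∣ (solve 4 (λ a b c d → (a :+ b) :- (c :+ d) := (a :- c) :+ (b :- d)) refl xm ym xn yn) ⟩
      ℚ.∣ (xm ℚ.- xn) ℚ.+ (ym ℚ.- yn) ∣
        ≤⟨ ℚ.∣p+q∣≤∣p∣+∣q∣ (xm ℚ.- xn) (ym ℚ.- yn) ⟩
      ℚ.∣ xm ℚ.- xn ∣ ℚ.+ ℚ.∣ ym ℚ.- yn ∣
        <⟨ ℚ.+-mono-< (f m n (ℕ.m⊔n≤o⇒m≤o M N p) (ℕ.m⊔n≤o⇒m≤o M N q))
                      (g m n (ℕ.m⊔n≤o⇒n≤o M N p) (ℕ.m⊔n≤o⇒n≤o M N q)) ⟩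
      ½ ℚ.* ε ℚ.+ ½ ℚ.* ε
        ≡⟨ halves ε ⟩
      ε ∎
      where open ℚ.≤-Reasoning

    neg-cauchy : ∀ x → Cauchy (λ n → ℚ.- seq x n)
    neg-cauchy x ε 0<ε with cauchy x ε 0<ε
    ... | N , f = N , λ m n p q → subst (ℚ._< ε)
      (trans (sym (ℚ.∣-p∣≡∣p∣ (seq x m ℚ.- seq x n)))
             (cong ℚ.∣_∣ (solve 2 (λ a b → :- (a :- b) := :- a :- (:- b)) refl (seq x m) (seq x n))))
      (f m n p q)

    bounded : ∀ x → ∃[ B ] 0ℚ ℚ.< B × ∃[ N ] ∀ n → N ℕ.≤ n → ℚ.∣ seq x n ∣ ℚ.≤ B
    bounded x with cauchy x 1ℚ (ℚ.positive⁻¹ 1ℚ)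
    ... | N , f = 1ℚ ℚ.+ ℚ.∣ seq x N ∣
        , ℚ.+-mono-<-≤ (ℚ.positive⁻¹ 1ℚ) (ℚ.0≤∣p∣ (seq x N))
        , N , λ n p → let xn = seq x n ; xN = seq x N in begin
      ℚ.∣ xn ∣
        ≡⟨ cong ℚ.∣_∣ (solve 2 (λ a b → a := (a :- b) :+ b) refl xn xN) ⟩
      ℚ.∣ (xn ℚ.- xN) ℚ.+ xN ∣
        ≤⟨ ℚ.∣p+q∣≤∣p∣+∣q∣ (xn ℚ.- xN) xN ⟩
      ℚ.∣ xn ℚ.- xN ∣ ℚ.+ ℚ.∣ xN ∣
        ≤⟨ ℚ.+-monoˡ-≤ ℚ.∣ xN ∣ (ℚ.<⇒≤ (f n N p ℕ.≤-refl)) ⟩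
      1ℚ ℚ.+ ℚ.∣ xN ∣ ∎
      where open ℚ.≤-Reasoning

    recip-inverse : ∀ {q} → 0ℚ ℚ.< q → q ℚ.* recip q ≡ 1ℚ
    recip-inverse {q} 0<q with q ℚ.≟ 0ℚ
    ... | yes q≡0 = contradiction (sym q≡0) (ℚ.<⇒≢ 0<q)
    ... | no  q≢0 = ℚ.*-inverseʳ q {{ℚ.≢-nonZero q≢0}}

    *-pos : ∀ {p q} → 0ℚ ℚ.< p → 0ℚ ℚ.< q → 0ℚ ℚ.< p ℚ.* q
    *-pos {p} {q} 0<p 0<q = subst (ℚ._< p ℚ.* q) (ℚ.*-zeroʳ p) (ℚ.*-monoʳ-<-pos p {{ℚ.positive 0<p}} 0<q)

    recip-pos : ∀ {q} → 0ℚ ℚ.< q → 0ℚ ℚ.< recip q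
    recip-pos {q} 0<q = ℚ.*-cancelˡ-<-nonNeg q {{ℚ.nonNegative (ℚ.<⇒≤ 0<q)}}
      (subst₂ ℚ._<_ (sym (ℚ.*-zeroʳ q)) (sym (recip-inverse 0<q)) (ℚ.positive⁻¹ 1ℚ))

    *-mono-≤ : ∀ {p q r s} → 0ℚ ℚ.≤ r → 0ℚ ℚ.≤ q → p ℚ.≤ q → r ℚ.≤ s → p ℚ.* r ℚ.≤ q ℚ.* s
    *-mono-≤ {p} {q} {r} {s} 0≤r 0≤q p≤q r≤s = ℚ.≤-trans
      (ℚ.*-monoʳ-≤-nonNeg r {{ℚ.nonNegative 0≤r}} p≤q)
      (ℚ.*-monoˡ-≤-nonNeg q {{ℚ.nonNegative 0≤q}} r≤s)

    scale : ∀ {A t d e} → 0ℚ ℚ.< A → 0ℚ ℚ.≤ d → t ℚ.≤ A → d ℚ.< e ℚ.* recip A → t ℚ.* d ℚ.< e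
    scale {A} {t} {d} {e} 0<A 0≤d t≤A d<e = begin-strict
      t ℚ.* d               ≤⟨ ℚ.*-monoʳ-≤-nonNeg d {{ℚ.nonNegative 0≤d}} t≤A ⟩
      A ℚ.* d               <⟨ ℚ.*-monoʳ-<-pos A {{ℚ.positive 0<A}} d<e ⟩
      A ℚ.* (e ℚ.* recip A) ≡⟨ solve 3 (λ a b c → a :* (b :* c) := b :* (a :* c)) refl A e (recip A) ⟩
      e ℚ.* (A ℚ.* recip A) ≡⟨ cong (e ℚ.*_) (recip-inverse 0<A) ⟩
      e ℚ.* 1ℚ              ≡⟨ ℚ.*-identityʳ e ⟩
      e                     ∎
      where open ℚ.≤-Reasoning

    *-split : ∀ a b c d → ℚ.∣ a ℚ.* b ℚ.- c ℚ.* d ∣ ℚ.≤ ℚ.∣ a ∣ ℚ.* ℚ.∣ b ℚ.- d ∣ ℚ.+ ℚ.∣ d ∣ ℚ.* ℚ.∣ a ℚ.- c ∣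
    *-split a b c d = begin
      ℚ.∣ a ℚ.* b ℚ.- c ℚ.* d ∣
        ≡⟨ cong ℚ.∣_∣ (solve 4 (λ a b c d → a :* b :- c :* d := a :* (b :- d) :+ d :* (a :- c)) refl a b c d) ⟩
      ℚ.∣ a ℚ.* (b ℚ.- d) ℚ.+ d ℚ.* (a ℚ.- c) ∣
        ≤⟨ ℚ.∣p+q∣≤∣p∣+∣q∣ (a ℚ.* (b ℚ.- d)) (d ℚ.* (a ℚ.- c)) ⟩
      ℚ.∣ a ℚ.* (b ℚ.- d) ∣ ℚ.+ ℚ.∣ d ℚ.* (a ℚ.- c) ∣
        ≡⟨ cong₂ ℚ._+_ (ℚ.∣p*q∣≡∣p∣*∣q∣ a (b ℚ.- d)) (ℚ.∣p*q∣≡∣p∣*∣q∣ d (a ℚ.- c)) ⟩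
      ℚ.∣ a ∣ ℚ.* ℚ.∣ b ℚ.- d ∣ ℚ.+ ℚ.∣ d ∣ ℚ.* ℚ.∣ a ℚ.- c ∣ ∎
      where open ℚ.≤-Reasoning

    *-cauchy : ∀ x y → Cauchy (λ n → seq x n ℚ.* seq y n)
    *-cauchy x y ε 0<ε =
      let B , 0<B , K , bx = bounded x
          C , 0<C , L , by = bounded y
          M , f = cauchy x (½ ℚ.* ε ℚ.* recip C) (*-pos (½* 0<ε) (recip-pos 0<C))
          N , g = cauchy y (½ ℚ.* ε ℚ.* recip B) (*-pos (½* 0<ε) (recip-pos 0<B))
      in (K ℕ.⊔ L) ℕ.⊔ (M ℕ.⊔ N) , λ m n p q →
      let xm = seq x m ; xn = seq x n ; ym = seq y m ; yn = seq y n
          p₁ = ℕ.m⊔n≤o⇒m≤o (K ℕ.⊔ L) (M ℕ.⊔ N) p ; p₂ = ℕ.m⊔n≤o⇒n≤o (K ℕ.⊔ L) (M ℕ.⊔ N) p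
          q₁ = ℕ.m⊔n≤o⇒m≤o (K ℕ.⊔ L) (M ℕ.⊔ N) q ; q₂ = ℕ.m⊔n≤o⇒n≤o (K ℕ.⊔ L) (M ℕ.⊔ N) q
      in ℚ.≤-<-trans (*-split xm ym xn yn) (subst (_ ℚ.<_) (halves ε) (ℚ.+-mono-<
           (scale {e = ½ ℚ.* ε} 0<B (ℚ.0≤∣p∣ (ym ℚ.- yn)) (bx m (ℕ.m⊔n≤o⇒m≤o K L p₁))
                  (g m n (ℕ.m⊔n≤o⇒n≤o M N p₂) (ℕ.m⊔n≤o⇒n≤o M N q₂)))
           (scale {e = ½ ℚ.* ε} 0<C (ℚ.0≤∣p∣ (xm ℚ.- xn)) (by n (ℕ.m⊔n≤o⇒n≤o K L q₁))
                  (f m n (ℕ.m⊔n≤o⇒m≤o M N p₂) (ℕ.m⊔n≤o⇒m≤o M N q₂)))))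

    recip-cauchy : ∀ x → Positive x → Cauchy (λ n → recip (seq x n))
    recip-cauchy x (δ , 0<δ , K , low) ε 0<ε
      with cauchy x (ε ℚ.* (δ ℚ.* δ)) (*-pos 0<ε (*-pos 0<δ 0<δ))
    ... | N , f = K ℕ.⊔ N , λ m n p q →
      let xm = seq x m ; xn = seq x n
          δ≤xm = low m (ℕ.m⊔n≤o⇒m≤o K N p) ; δ≤xn = low n (ℕ.m⊔n≤o⇒m≤o K N q)
          0<xm = ℚ.<-≤-trans 0<δ δ≤xm ; 0<xn = ℚ.<-≤-trans 0<δ δ≤xn
          0<xx = *-pos 0<xm 0<xn
      in ℚ.*-cancelʳ-<-nonNeg (xm ℚ.* xn) {{ℚ.nonNegative (ℚ.<⇒≤ 0<xx)}} (begin-strict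
      ℚ.∣ recip xm ℚ.- recip xn ∣ ℚ.* (xm ℚ.* xn)
        ≡⟨ cong (ℚ.∣ recip xm ℚ.- recip xn ∣ ℚ.*_) (sym (ℚ.0≤p⇒∣p∣≡p (ℚ.<⇒≤ 0<xx))) ⟩
      ℚ.∣ recip xm ℚ.- recip xn ∣ ℚ.* ℚ.∣ xm ℚ.* xn ∣
        ≡⟨ sym (ℚ.∣p*q∣≡∣p∣*∣q∣ (recip xm ℚ.- recip xn) (xm ℚ.* xn)) ⟩
      ℚ.∣ (recip xm ℚ.- recip xn) ℚ.* (xm ℚ.* xn) ∣
        ≡⟨ cong ℚ.∣_∣ (solve 4 (λ u v a b → (u :- v) :* (a :* b) := (a :* u) :* b :- (b :* v) :* a)
                         refl (recip xm) (recip xn) xm xn) ⟩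
      ℚ.∣ (xm ℚ.* recip xm) ℚ.* xn ℚ.- (xn ℚ.* recip xn) ℚ.* xm ∣
        ≡⟨ cong₂ (λ s t → ℚ.∣ s ℚ.* xn ℚ.- t ℚ.* xm ∣) (recip-inverse 0<xm) (recip-inverse 0<xn) ⟩
      ℚ.∣ 1ℚ ℚ.* xn ℚ.- 1ℚ ℚ.* xm ∣
        ≡⟨ cong₂ (λ s t → ℚ.∣ s ℚ.- t ∣) (ℚ.*-identityˡ xn) (ℚ.*-identityˡ xm) ⟩
      ℚ.∣ xn ℚ.- xm ∣
        <⟨ f n m (ℕ.m⊔n≤o⇒n≤o K N q) (ℕ.m⊔n≤o⇒n≤o K N p) ⟩
      ε ℚ.* (δ ℚ.* δ)
        ≤⟨ ℚ.*-monoˡ-≤-nonNeg ε {{ℚ.nonNegative (ℚ.<⇒≤ 0<ε)}}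
             (*-mono-≤ (ℚ.<⇒≤ 0<δ) (ℚ.<⇒≤ 0<xm) δ≤xm δ≤xn) ⟩
      ε ℚ.* (xm ℚ.* xn) ∎)
      where open ℚ.≤-Reasoning

  infixl 6 _+_
  infixl 7 _*_
  infix  8 -_

  _+_ : ℝ → ℝ → ℝ
  x + y = mkℝ (λ n → seq x n ℚ.+ seq y n) (+-cauchy x y)

  -_ : ℝ → ℝ
  - x = mkℝ (λ n → ℚ.- seq x n) (neg-cauchy x)

  _*_ : ℝ → ℝ → ℝ
  x * y = mkℝ (λ n → seq x n ℚ.* seq y n) (*-cauchy x y)

  _⁻¹⟨_⟩ : (x : ℝ) → Positive x → ℝ
  x ⁻¹⟨ 0<x ⟩ = mkℝ (λ n → recip (seq x n)) (recip-cauchy x 0<x)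

open Real using (ℝ; fromℚ)

------------------------------------------------------------------------
-- Complex numbers

record ℂ : Set where
  constructor _+i_
  field
    re im : ℝ

open ℂ public

ℂ-rawRing : RawRing 0ℓ 0ℓ
ℂ-rawRing = record
  { Carrier = ℂ
  ; _≈_     = λ z w → re z ≃ re w × im z ≃ im w
  ; _+_     = λ z w → (re z + re w) +i (im z + im w)
  ; _*_     = λ z w → (re z * re w + - (im z * im w)) +i (re z * im w + im z * re w)
  ; -_      = λ z → (- re z) +i (- im z)
  ; 0#      = fromℚ 0ℚ +i fromℚ 0ℚ
  ; 1#      = fromℚ 1ℚ +i fromℚ 0ℚ
  }
  where open Real

∣_∣² : ℂ → ℝ
∣ z ∣² = re z Real.* re z Real.+ im z Real.* im z

open RawRing ℂ-rawRing public using (_≈_; _+_; _*_; -_; 0#; 1#)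
open import Algebra.Definitions.RawSemiring (RawRing.rawSemiring ℂ-rawRing) public using (_^_; sum)
  renaming (_×_ to _×ᶜ_)

infixl 6 _-_
_-_ : ℂ → ℂ → ℂ
z - w = z + - w

-- Distinctness is apartness, i.e. positive distance. Classically this is ¬ z ≈ w,
-- but only the positive form yields an inverse of z - w constructively.

infix 4 _#0 _#_
_#0 : ℂ → Set
z #0 = Real.Positive ∣ z ∣²

_#_ : ℂ → ℂ → Set
z # w = (z - w) #0

infix 8 _⁻¹⟨_⟩
_⁻¹⟨_⟩ : (z : ℂ) → z #0 → ℂ
z ⁻¹⟨ z#0 ⟩ = (re z Real.* r) +i ((Real.- im z) Real.* r)
  where r = ∣ z ∣² Real.⁻¹⟨ z#0 ⟩

infixl 7 _/_⟨_⟩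
_/_⟨_⟩ : (w z : ℂ) → z #0 → ℂ
w / z ⟨ z#0 ⟩ = w * z ⁻¹⟨ z#0 ⟩

fromℕ : ℕ → ℂ
fromℕ n = n ×ᶜ 1#

open LinearAlgebra ℂ-rawRing public using (I; _·_; _≋_; Diagonalisable; det)
open Polynomials ℂ-rawRing public using (coeffℤ; charPoly)

------------------------------------------------------------------------
-- Principal minors

-- The increasing enumeration of the elements of α.
enumerate : ∀ {n} (α : Subset n) → Fin ∣ α ∣ → Fin n
enumerate (inside  ∷ α) zero    = zero
enumerate (inside  ∷ α) (suc i) = suc (enumerate α i)
enumerate (outside ∷ α) i       = suc (enumerate α i)

infix 9 _[_]
_[_] : ∀ {v} → Matrix ℂ v v → (α : Subset v) → Matrix ℂ ∣ α ∣ ∣ α ∣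
(A [ α ]) i j = A (enumerate α i) (enumerate α j)

D : ∀ {v} → Matrix ℂ v v → ℕ → Pred ℂ 0ℓ
D A k z = ∃[ α ] ∣ α ∣ ≡ k × det (A [ α ]) ≈ z

-- The exponent v - k - |α| may be negative, in which case the coefficient is 0;
-- truncated subtraction would wrongly pick the constant coefficient.
charCoeff : ∀ {v} → Matrix ℂ v v → Subset v → ℕ → ℂ
charCoeff {v} A α k = coeffℤ (ℤ.+ v ℤ.- ℤ.+ k ℤ.- ℤ.+ ∣ α ∣) (charPoly (A [ ∁ α ]))

-- The binomial coefficient, zero when either argument is negative.
binom : ℤ.ℤ → ℤ.ℤ → ℕ
binom (ℤ.+ n)    (ℤ.+ k)    = n C k
binom (ℤ.+ _)    ℤ.-[1+ _ ] = 0
binom ℤ.-[1+ _ ] _          = 0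

------------------------------------------------------------------------
-- Hypergraphs and designs

HasSize : ∀ {a ℓ} {A : Set a} → Pred A ℓ → ℕ → Set (a ⊔ ℓ)
HasSize P n = ∃[ xs ] Unique xs × (∀ x → x ∈ xs ⇔ P x) × length xs ≡ n

record Hypergraph (v k : ℕ) : Set₁ where
  field
    Hyperedge : Pred (Subset v) 0ℓ
    uniform   : ∀ {α} → Hyperedge α → ∣ α ∣ ≡ k

ℌ : ∀ {v} → Matrix ℂ v v → (k : ℕ) → ℂ → Hypergraph v k
ℌ A k a = record
  { Hyperedge = λ α → ∣ α ∣ ≡ k × det (A [ α ]) ≈ a
  ; uniform   = proj₁
  }

adjacency : ∀ {v} → (Fin v → Fin v → Bool) → Matrix ℂ v v
adjacency R x y = if R x y then 1# else 0#

record AssociationScheme (v d : ℕ) : Set where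
  field
    R : Fin (suc d) → Fin v → Fin v → Bool

  A : Fin (suc d) → Matrix ℂ v v
  A i = adjacency (R i)

  field
    d≥1       : 1 ℕ.≤ d
    nonempty  : ∀ i → ∃[ x ] ∃[ y ] T (R i x y)
    identity  : A zero ≋ I v
    partition : (λ x y → sum λ i → A i x y) ≋ λ _ _ → 1#
    symmetric : ∀ i → (λ x y → A i y x) ≋ A i
    closed    : ∀ i j → ∃ λ (p : Fin (suc d) → ℂ) → A i · A j ≋ λ x y → sum λ h → p h * A h x y

  R̃ : Fin (suc d) → Pred (Subset v) 0ℓ
  R̃ i α = ∃[ x ] ∃[ y ] T (R i x y) × α ≡ ⁅ x ⁆ ∪ ⁅ y ⁆

-- The classes 1, …, d are the indices suc j with j : Fin d.
record IsPBIBD {v d} (𝒳 : AssociationScheme v d) (k : ℕ) (μ : Fin d → ℕ) (H : Hypergraph v k) : Set where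
  open AssociationScheme 𝒳
  open Hypergraph H
  field
    degree   : ℕ
    degree>0 : 0 ℕ.< degree
    regular  : ∀ x → HasSize (λ α → Hyperedge α × x ∈ₛ α) degree
    balanced : ∀ j x y → T (R (suc j) x y) → HasSize (λ α → Hyperedge α × x ∈ₛ α × y ∈ₛ α) (μ j)

-- For every α the k-subsets β ⊇ α split into those with det A[β] equal to a, b
-- and c. Their numbers N_a, N_b and N_c satisfy
--   N_a + N_b + N_c = C(v - |α|, k - |α|)   and   a N_a + b N_b + c N_c = S(α),
-- where S(α) is the sum of the minors det A[β] with |β| = k and β ⊇ α.
-- Eliminating N_b determines (a - b) N_a from S(α) and N_c. By
--   det(xI - M) = Σ_β (-1)^|β| det M[β] x^(n - |β|),
-- (-1)^k c_A(α, k) is the sum of the k-minors avoiding α, and inclusion–exclusion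
-- expresses S({x}) and S({x, y}) by those sums. So N_a does not depend on the
-- choice of x, nor on that of x and y within a class of the scheme, because the
-- complex numbers have characteristic zero.

module Submission where

open import Defs
  using (Matrix; module LinearAlgebra; module Polynomials; module Real; enumerate; binom; HasSize)
open import Algebra.Bundles using (CommutativeRing)
open import Algebra.Morphism.Structures using (module RingMorphisms)
open import Data.Bool.Base using (Bool; true; false; if_then_else_; T; _∧_; not)
import Data.Bool.Properties as Bool
open import Data.Fin.Base using (Fin; zero; suc; toℕ; punchIn; punchOut; pinch; cast)
import Data.Fin.Properties as Fin
open import Data.Fin.Subset
  using (Subset; inside; outside; ∣_∣; ∁; ⊥; ⊤; ⁅_⁆; _∪_; _⊆_; Nonempty) renaming (_∈_ to _∈ₛ_)
import Data.Fin.Subset.Properties as Sub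
import Data.Integer.Base as ℤ
open import Data.Integer.Base using (+_) renaming (_-_ to _-ℤ_)
import Data.Integer.Properties as ℤ
open import Data.Integer.Solver using () renaming (module +-*-Solver to ℤ-Solver)
open import Data.List.Base using (List; []; _∷_; _++_; map; foldr; filter; length)
open import Data.List.Membership.Propositional using (_∈_)
import Data.List.Membership.Propositional.Properties as List
open import Data.List.Membership.Propositional.Properties.WithK using (unique∧set⇒bag)
open import Data.List.Relation.Binary.BagAndSetEquality using (∼bag⇒↭)
open import Data.List.Relation.Binary.Permutation.Propositional.Properties using (↭-length)
import Data.List.Relation.Unary.All as All
import Data.List.Relation.Unary.AllPairs as AllPairs
open import Data.List.Relation.Unary.Any using (here)
open import Data.List.Relation.Unary.Unique.Propositional using (Unique)
import Data.List.Relation.Unary.Unique.Propositional.Properties as Unique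
import Data.Nat.Base as ℕ
open import Data.Nat.Base using (ℕ; zero; suc; _≤_)
open import Data.Nat.Combinatorics using (_C_; nCk+nC[k+1]≡[n+1]C[k+1])
import Data.Nat.Properties as ℕ
open import Data.Product.Base using (∃-syntax; _×_; _,_; proj₁; proj₂)
open import Data.Product.Function.NonDependent.Propositional using (_×-⇔_)
import Data.Rational.Base as ℚ
open import Data.Rational.Base using (ℚ; 0ℚ; 1ℚ; ½)
import Data.Rational.Properties as ℚ
open import Data.Rational.Solver using () renaming (module +-*-Solver to ℚ-Solver)
open import Data.Sum.Base using (_⊎_; inj₁; inj₂; reduce)
import Data.Vec.Base as Vec
open import Data.Vec.Base using ([]; _∷_; lookup; insertAt)
import Data.Vec.Properties as Vec
open import Function.Base using (_∘_)
open import Function.Bundles using (_⇔_; mk⇔; Equivalence)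
open import Function.Construct.Composition using (_⇔-∘_)
open import Function.Construct.Identity using (⇔-id)
open import Function.Construct.Symmetry using (⇔-sym)
open import Level using (0ℓ)
open import Relation.Binary.Definitions using (tri<; tri≈; tri>)
import Relation.Binary.PropositionalEquality as ≡
open import Relation.Binary.PropositionalEquality using (_≡_; _≢_)
import Relation.Binary.Reasoning.Setoid
open import Relation.Nullary using (¬_; yes; no; does; contradiction)
open import Relation.Nullary.Decidable using (dec-true; dec-false)
open import Relation.Unary using (Pred; Decidable; _≐_)
open RingMorphisms using (IsRingHomomorphism)

-- Determinants

-- The overview takes the expansion of `det (xI - M)` for granted, whereas `det` is Laplace
-- expansion along the first row and nothing else. The one tool is `det-perturb`: changing a single
-- entry changes the determinant by the change times the cofactor. Adding `x` to the diagonal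
-- entries one at a time then produces the sum over principal minors. This is done over an arbitrary
-- commutative ring, because it is applied over the polynomials with `x = X`, while the minors are
-- evaluated in the base ring. The other obstacle is that equality of complex numbers is not
-- decidable, so hyperedges cannot be counted by testing determinants. The hypothesis on `D A k`
-- replaces the test: it assigns one of `a`, `b`, `c` to every `k`-minor, and apartness excludes the
-- other two. Hence each family of hyperedges is a filtered list with a natural number as length.
-- The linear equations for these lengths live in ℂ, and injectivity of `fromℕ` carries their
-- consequences back to ℕ, where the degree and the pair counts of a design have to be.

minor : ∀ {a} {X : Set a} {m n} → Fin (suc m) → Fin (suc n) → Matrix X (suc m) (suc n) → Matrix X m n
minor i j A r s = A (punchIn i r) (punchIn j s)

-- `pinch l j` is the position of column `j` once column `punchIn j l` has been deleted: still `j`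
-- if `j ≤ l`, one less if `j > l`.
punchIn-pinch : ∀ {n} (j : Fin (suc (suc n))) l → punchIn (punchIn j l) (pinch l j) ≡ j
punchIn-pinch         zero    l       = ≡.refl
punchIn-pinch         (suc j) zero    = ≡.refl
punchIn-pinch {suc n} (suc j) (suc l) = ≡.cong suc (punchIn-pinch j l)

-- Both sides enumerate, in increasing order, the columns other than `j` and `punchIn j l`, so the
-- order of the two deletions does not matter.
punchIn-punchIn : ∀ {n} (j : Fin (suc (suc n))) l s →
  punchIn (punchIn j l) (punchIn (pinch l j) s) ≡ punchIn j (punchIn l s)
punchIn-punchIn zero    l       s       = ≡.refl
punchIn-punchIn (suc j) zero    s       = ≡.refl
punchIn-punchIn (suc j) (suc l) zero    = ≡.refl
punchIn-punchIn (suc j) (suc l) (suc s) = ≡.cong suc (punchIn-punchIn j l s)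

module Determinant {c ℓ} (R : CommutativeRing c ℓ) where

  open CommutativeRing R hiding (_-_; zero)
  open LinearAlgebra rawRing using (det; _≋_)
  open import Algebra.Properties.Semiring.Exp semiring using (_^_)
  open import Algebra.Properties.Semiring.Sum semiring
    using (sum; sum-cong-≋; sum-remove; ∑-distrib-+; *-distribˡ-sum)
  open import Algebra.Properties.Ring ring using (-1*x≈-x; -‿involutive)
  open import Algebra.Solver.Ring.NaturalCoefficients.Default commutativeSemiring
    using (solve; _:=_; _:*_; _:+_; con)
  open import Relation.Binary.Reasoning.Setoid setoid

  sign : ℕ → Carrier
  sign n = (- 1#) ^ n

  -1*-1≈1 : - 1# * - 1# ≈ 1#
  -1*-1≈1 = trans (-1*x≈-x (- 1#)) (-‿involutive 1#)

  sign²≈1 : ∀ n → sign n * sign n ≈ 1#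
  sign²≈1 zero    = *-identityˡ 1#
  sign²≈1 (suc n) = begin
    - 1# * sign n * (- 1# * sign n)
      ≈⟨ solve 2 (λ m s → m :* s :* (m :* s) := m :* m :* (s :* s)) refl (- 1#) (sign n) ⟩
    - 1# * - 1# * (sign n * sign n)
      ≈⟨ *-cong -1*-1≈1 (sign²≈1 n) ⟩
    1# * 1#
      ≈⟨ *-identityˡ 1# ⟩
    1# ∎

  det-cong : ∀ {n} {A B : Matrix Carrier n n} → A ≋ B → det A ≈ det B
  det-cong {zero}  A≋B = refl
  det-cong {suc n} A≋B = sum-cong-≋ λ j →
    *-cong (*-congˡ {x = sign (toℕ j)} (A≋B zero j)) (det-cong λ r s → A≋B (suc r) (punchIn j s))

  -- Deleting the columns j and l of a pair in either order: the signs of the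
  -- two Laplace expansions differ by a transposition.
  sign-punchIn : ∀ {n} (j : Fin (suc (suc n))) l →
    sign (toℕ (punchIn j l)) * sign (toℕ (pinch l j)) ≈ - 1# * (sign (toℕ j) * sign (toℕ l))
  sign-punchIn zero l = solve 2 (λ m s → m :* s :* con 1 := m :* (con 1 :* s)) refl _ _
  sign-punchIn (suc j) zero = begin
    1# * s                  ≈⟨ *-congʳ -1*-1≈1 ⟨
    - 1# * - 1# * s         ≈⟨ solve 2 (λ m s → m :* m :* s := m :* (m :* s :* con 1)) refl _ _ ⟩
    - 1# * (- 1# * s * 1#)  ∎
    where
    s = sign (toℕ j)
  sign-punchIn {suc n} (suc j) (suc l) = begin
    - 1# * a * (- 1# * b)
      ≈⟨ solve 3 (λ m a b → m :* a :* (m :* b) := m :* m :* (a :* b)) refl _ a b ⟩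
    - 1# * - 1# * (a * b)
      ≈⟨ *-congˡ (sign-punchIn j l) ⟩
    - 1# * - 1# * (- 1# * (sj * sl))
      ≈⟨ solve 3 (λ m a b → m :* m :* (m :* (a :* b)) := m :* (m :* a :* (m :* b))) refl _ sj sl ⟩
    - 1# * (- 1# * sj * (- 1# * sl)) ∎
    where
    a = sign (toℕ (punchIn j l))
    b = sign (toℕ (pinch l j))
    sj = sign (toℕ j)
    sl = sign (toℕ l)

  -- The determinant is affine in each entry, with the cofactor as slope. In the first row this is
  -- read off the Laplace expansion. In a lower row every term outside column `j` changes by
  -- induction, and the changes reassemble into the first-row expansion of `minor (suc i) j A`.
  det-perturb : ∀ {n} (A A′ : Matrix Carrier (suc n) (suc n)) i j x →
    A′ i j ≈ A i j + x → (∀ r s → r ≢ i ⊎ s ≢ j → A′ r s ≈ A r s) →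
    det A′ ≈ det A + sign (toℕ i) * sign (toℕ j) * (x * det (minor i j A))
  det-perturb A A′ zero j x eq same = begin
    det A′
      ≈⟨ sum-remove {i = j} (term A′) ⟩
    term A′ j + sum (λ l → term A′ (punchIn j l))
      ≈⟨ +-cong (*-cong (*-congˡ eq) (det-cong λ r s → same (suc r) (punchIn j s) (inj₁ λ ())))
                (sum-cong-≋ λ l → *-cong
                  (*-congˡ (same zero (punchIn j l) (inj₂ (Fin.punchInᵢ≢i j l))))
                  (det-cong λ r s → same (suc r) (punchIn (punchIn j l) s) (inj₁ λ ()))) ⟩
    σ * (A zero j + x) * d + rest
      ≈⟨ solve 5 (λ s a x d r → s :* (a :+ x) :* d :+ r := s :* a :* d :+ r :+ con 1 :* s :* (x :* d))
               refl σ (A zero j) x d rest ⟩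
    term A j + rest + 1# * σ * (x * d)
      ≈⟨ +-congʳ (sum-remove {i = j} (term A)) ⟨
    det A + 1# * σ * (x * d) ∎
    where
    term : Matrix Carrier _ _ → Fin _ → Carrier
    term B l = sign (toℕ l) * B zero l * det (minor zero l B)
    σ = sign (toℕ j)
    d = det (minor zero j A)
    rest = sum (λ l → term A (punchIn j l))
  det-perturb {suc n} A A′ (suc i) j x eq same = begin
    det A′
      ≈⟨ sum-remove {i = j} (term A′) ⟩
    term A′ j + sum (λ l → term A′ (punchIn j l))
      ≈⟨ +-cong (*-cong (*-congˡ (same zero j (inj₁ λ ())))
                        (det-cong λ r s → same (suc r) (punchIn j s) (inj₂ (Fin.punchInᵢ≢i j s))))
                (sum-cong-≋ step) ⟩
    term A j + sum (λ l → term A (punchIn j l) + f * (x * term B l))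
      ≈⟨ +-congˡ (∑-distrib-+ (λ l → term A (punchIn j l)) (λ l → f * (x * term B l))) ⟩
    term A j + (sum (λ l → term A (punchIn j l)) + sum (λ l → f * (x * term B l)))
      ≈⟨ +-assoc _ _ _ ⟨
    term A j + sum (λ l → term A (punchIn j l)) + sum (λ l → f * (x * term B l))
      ≈⟨ +-cong (sum-remove {i = j} (term A))
           (trans (*-congˡ (*-distribˡ-sum x (term B))) (*-distribˡ-sum f (λ l → x * term B l))) ⟨
    det A + f * (x * det B) ∎
    where
    term : ∀ {m} → Matrix Carrier (suc m) (suc m) → Fin (suc m) → Carrier
    term B l = sign (toℕ l) * B zero l * det (minor zero l B)
    B = minor (suc i) j A
    f = sign (suc (toℕ i)) * sign (toℕ j)
    step : ∀ l → term A′ (punchIn j l) ≈ term A (punchIn j l) + f * (x * term B l)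
    step l = begin
      sp * A′ zero (punchIn j l) * det (minor zero (punchIn j l) A′)
        ≈⟨ *-cong (*-congˡ (same zero (punchIn j l) (inj₁ λ ())))
             -- After row zero and column `punchIn j l` are deleted, the changed entry sits in row
             -- `i` and column `pinch l j`.
             (det-perturb (minor zero (punchIn j l) A) (minor zero (punchIn j l) A′) i (pinch l j) x
               (≡.subst (λ k → A′ (suc i) k ≈ A (suc i) k + x) (≡.sym (punchIn-pinch j l)) eq)
               λ { r s (inj₁ r≢i) → same (suc r) _ (inj₁ (r≢i ∘ Fin.suc-injective))
                 ; r s (inj₂ s≢) → same (suc r) _ (inj₂ λ p → s≢
                     (Fin.punchIn-injective (punchIn j l) s (pinch l j)
                       (≡.trans p (≡.sym (punchIn-pinch j l))))) }) ⟩
      sp * a * (d + si * sq * (x * det (minor i (pinch l j) (minor zero (punchIn j l) A))))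
        ≈⟨ *-congˡ (+-congˡ (*-congˡ (*-congˡ (det-cong λ r s →
             reflexive (≡.cong (A (suc (punchIn i r))) (punchIn-punchIn j l s)))))) ⟩
      sp * a * (d + si * sq * (x * e))
        ≈⟨ solve 7 (λ sp a d si sq x e → sp :* a :* (d :+ si :* sq :* (x :* e)) :=
                     sp :* a :* d :+ sp :* sq :* (a :* si :* x :* e)) refl sp a d si sq x e ⟩
      sp * a * d + sp * sq * (a * si * x * e)
        ≈⟨ +-congˡ (*-congʳ (sign-punchIn j l)) ⟩
      sp * a * d + - 1# * (sj * sl) * (a * si * x * e)
        ≈⟨ solve 8 (λ t m sj sl a si x e → t :+ m :* (sj :* sl) :* (a :* si :* x :* e) :=
                     t :+ m :* si :* sj :* (x :* (sl :* a :* e))) refl (sp * a * d) (- 1#) sj sl a si x e ⟩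
      sp * a * d + f * (x * (sl * a * e)) ∎
      where
      sp = sign (toℕ (punchIn j l))
      sq = sign (toℕ (pinch l j))
      si = sign (toℕ i)
      sj = sign (toℕ j)
      sl = sign (toℕ l)
      a = A zero (punchIn j l)
      d = det (minor zero (punchIn j l) A)
      e = det (minor zero l B)

-- Principal minors

-- An explicit list serves two purposes: it indexes sums in any ring, and filtered it is the witness
-- that `HasSize` asks for.
supersets : ∀ {n} → Subset n → List (Subset n)
supersets []            = [] ∷ []
supersets (inside  ∷ α) = map (inside ∷_) (supersets α)
supersets (outside ∷ α) = map (inside ∷_) (supersets α) ++ map (outside ∷_) (supersets α)

subsets : ∀ n → List (Subset n)
subsets n = supersets (⊥ {n})

principal : ∀ {a} {X : Set a} {n} → Matrix X n n → (α : Subset n) → Matrix X ∣ α ∣ ∣ α ∣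
principal A α i j = A (enumerate α i) (enumerate α j)

∣insertAt-outside∣ : ∀ {n} (p : Fin (suc n)) (β : Subset n) → ∣ insertAt β p outside ∣ ≡ ∣ β ∣
∣insertAt-outside∣ zero    β             = ≡.refl
∣insertAt-outside∣ (suc p) (inside  ∷ β) = ≡.cong suc (∣insertAt-outside∣ p β)
∣insertAt-outside∣ (suc p) (outside ∷ β) = ∣insertAt-outside∣ p β

enumerate-insertAt-outside : ∀ {n} (p : Fin (suc n)) (β : Subset n) i →
  enumerate (insertAt β p outside) i ≡ punchIn p (enumerate β (cast (∣insertAt-outside∣ p β) i))
enumerate-insertAt-outside zero    β             i       = ≡.cong (suc ∘ enumerate β) (≡.sym (Fin.cast-is-id ≡.refl i))
enumerate-insertAt-outside (suc p) (inside  ∷ β) zero    = ≡.refl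
enumerate-insertAt-outside (suc p) (inside  ∷ β) (suc i) = ≡.cong suc (enumerate-insertAt-outside p β i)
enumerate-insertAt-outside (suc p) (outside ∷ β) i       = ≡.cong suc (enumerate-insertAt-outside p β i)

∣∁insertAt-outside∣ : ∀ {n} (p : Fin (suc n)) (β : Subset n) → ∣ ∁ (insertAt β p outside) ∣ ≡ suc ∣ ∁ β ∣
∣∁insertAt-outside∣ zero    β             = ≡.refl
∣∁insertAt-outside∣ (suc p) (inside  ∷ β) = ∣∁insertAt-outside∣ p β
∣∁insertAt-outside∣ (suc p) (outside ∷ β) = ≡.cong suc (∣∁insertAt-outside∣ p β)

∣∁insertAt-inside∣ : ∀ {n} (p : Fin (suc n)) (β : Subset n) → ∣ ∁ (insertAt β p inside) ∣ ≡ ∣ ∁ β ∣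
∣∁insertAt-inside∣ zero    β             = ≡.refl
∣∁insertAt-inside∣ (suc p) (inside  ∷ β) = ∣∁insertAt-inside∣ p β
∣∁insertAt-inside∣ (suc p) (outside ∷ β) = ≡.cong suc (∣∁insertAt-inside∣ p β)

lookup-⊤ : ∀ {n} (i : Fin n) → lookup ⊤ i ≡ inside
lookup-⊤ i = Vec.lookup-replicate i inside

∣⊤∣ : ∀ n → n ≡ ∣ ⊤ {n} ∣
∣⊤∣ n = ≡.sym (Sub.∣⊤∣≡n n)

enumerate-⊤ : ∀ {n} (i : Fin n) → enumerate ⊤ (cast (∣⊤∣ n) i) ≡ i
enumerate-⊤ zero    = ≡.refl
enumerate-⊤ (suc i) = ≡.cong suc (enumerate-⊤ i)

supersets-⊤ : ∀ n → supersets (⊤ {n}) ≡ ⊤ ∷ []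
supersets-⊤ zero    = ≡.refl
supersets-⊤ (suc n) = ≡.cong (map (inside ∷_)) (supersets-⊤ n)

-- An index `p` outside the set is where `det-shift` undoes a shift. In the `insertAt` form both
-- resulting sets are at hand: `insertAt α p inside`, where `p` has joined, and `α`, where `p` has
-- been deleted from the index range.
data OutsideView : ∀ {n} → Subset n → Set where
  none   : ∀ {n} → OutsideView (⊤ {n})
  insert : ∀ {n} (p : Fin (suc n)) (α : Subset n) → OutsideView (insertAt α p outside)

outsideView : ∀ {n} (α : Subset n) → OutsideView α
outsideView []            = none
outsideView (outside ∷ α) = insert zero α
outsideView (inside ∷ α) with outsideView α
... | none       = none
... | insert p β = insert (suc p) (inside ∷ β)

module PrincipalMinors {c ℓ} (R : CommutativeRing c ℓ) where

  open CommutativeRing R hiding (_-_; zero)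
  open LinearAlgebra rawRing using (det)
  open Determinant R
  open import Algebra.Properties.Semiring.Exp semiring using (_^_; ^-congʳ)
  open import Algebra.Solver.Ring.NaturalCoefficients.Default commutativeSemiring
    using (solve; _:=_; _:*_; _:+_)
  open import Relation.Binary.Reasoning.Setoid setoid

  ∑ : ∀ {a} {X : Set a} → List X → (X → Carrier) → Carrier
  ∑ xs f = foldr (λ x s → f x + s) 0# xs

  ∑-cong : ∀ {a} {X : Set a} (xs : List X) {f g : X → Carrier} → (∀ x → f x ≈ g x) → ∑ xs f ≈ ∑ xs g
  ∑-cong []       f≈g = refl
  ∑-cong (x ∷ xs) f≈g = +-cong (f≈g x) (∑-cong xs f≈g)

  ∑-map : ∀ {a b} {X : Set a} {Y : Set b} (h : X → Y) xs f → ∑ (map h xs) f ≈ ∑ xs (f ∘ h)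
  ∑-map h []       f = refl
  ∑-map h (x ∷ xs) f = +-congˡ (∑-map h xs f)

  ∑-++ : ∀ {a} {X : Set a} (xs ys : List X) f → ∑ (xs ++ ys) f ≈ ∑ xs f + ∑ ys f
  ∑-++ []       ys f = sym (+-identityˡ _)
  ∑-++ (x ∷ xs) ys f = trans (+-congˡ (∑-++ xs ys f)) (sym (+-assoc _ _ _))

  ∑-distrib-+ : ∀ {a} {X : Set a} (xs : List X) f g → ∑ xs (λ x → f x + g x) ≈ ∑ xs f + ∑ xs g
  ∑-distrib-+ []       f g = sym (+-identityˡ _)
  ∑-distrib-+ (x ∷ xs) f g = trans (+-congˡ (∑-distrib-+ xs f g))
    (solve 4 (λ a b c d → a :+ b :+ (c :+ d) := a :+ c :+ (b :+ d)) refl (f x) (g x) (∑ xs f) (∑ xs g))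

  *-distribˡ-∑ : ∀ {a} {X : Set a} (xs : List X) f y → y * ∑ xs f ≈ ∑ xs (λ x → y * f x)
  *-distribˡ-∑ []       f y = zeroʳ y
  *-distribˡ-∑ (x ∷ xs) f y = trans (distribˡ y (f x) (∑ xs f)) (+-congˡ (*-distribˡ-∑ xs f y))

  ∑-zero : ∀ {a} {X : Set a} (xs : List X) f → (∀ x → f x ≈ 0#) → ∑ xs f ≈ 0#
  ∑-zero []       f f≈0 = refl
  ∑-zero (x ∷ xs) f f≈0 = trans (+-cong (f≈0 x) (∑-zero xs f f≈0)) (+-identityˡ 0#)

  ∑-supersets-inside : ∀ {n} (α : Subset n) f →
    ∑ (supersets (inside ∷ α)) f ≈ ∑ (supersets α) (f ∘ (inside ∷_))
  ∑-supersets-inside α f = ∑-map (inside ∷_) (supersets α) f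

  ∑-supersets-outside : ∀ {n} (α : Subset n) f →
    ∑ (supersets (outside ∷ α)) f ≈ ∑ (supersets α) (f ∘ (inside ∷_)) + ∑ (supersets α) (f ∘ (outside ∷_))
  ∑-supersets-outside α f = trans (∑-++ (map (inside ∷_) (supersets α)) (map (outside ∷_) (supersets α)) f)
    (+-cong (∑-map (inside ∷_) (supersets α) f) (∑-map (outside ∷_) (supersets α) f))

  -- A superset either contains `p`, and then contains the set with `p` added, or omits `p`, and
  -- then arises from a superset of `α`. For `p` beyond the head, the head coordinate is split as
  -- well and the four sums are regrouped.
  ∑-supersets-insertAt : ∀ {n} (p : Fin (suc n)) (α : Subset n) f →
    ∑ (supersets (insertAt α p outside)) f ≈
    ∑ (supersets (insertAt α p inside)) f + ∑ (supersets α) (λ β → f (insertAt β p outside))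
  ∑-supersets-insertAt zero α f = trans (∑-supersets-outside α f) (+-congʳ (sym (∑-supersets-inside α f)))
  ∑-supersets-insertAt (suc p) (inside ∷ α) f = begin
    ∑ (supersets (inside ∷ insertAt α p outside)) f
      ≈⟨ ∑-supersets-inside (insertAt α p outside) f ⟩
    ∑ (supersets (insertAt α p outside)) (f ∘ (inside ∷_))
      ≈⟨ ∑-supersets-insertAt p α (f ∘ (inside ∷_)) ⟩
    ∑ (supersets (insertAt α p inside)) (f ∘ (inside ∷_)) + ∑ (supersets α) (λ β → f (inside ∷ insertAt β p outside))
      ≈⟨ +-cong (∑-supersets-inside (insertAt α p inside) f)
                (∑-supersets-inside α (λ β → f (insertAt β (suc p) outside))) ⟨
    _ ∎
  ∑-supersets-insertAt (suc p) (outside ∷ α) f = begin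
    ∑ (supersets (outside ∷ insertAt α p outside)) f
      ≈⟨ ∑-supersets-outside (insertAt α p outside) f ⟩
    ∑ (supersets (insertAt α p outside)) (f ∘ (inside ∷_)) + ∑ (supersets (insertAt α p outside)) (f ∘ (outside ∷_))
      ≈⟨ +-cong (∑-supersets-insertAt p α (f ∘ (inside ∷_))) (∑-supersets-insertAt p α (f ∘ (outside ∷_))) ⟩
    _
      ≈⟨ solve 4 (λ a b c d → a :+ b :+ (c :+ d) := a :+ c :+ (b :+ d)) refl _ _ _ _ ⟩
    _
      ≈⟨ +-cong (∑-supersets-outside (insertAt α p inside) f)
                (∑-supersets-outside α (λ β → f (insertAt β (suc p) outside))) ⟨
    _ ∎

  -- Two descriptions of one index set have sizes that are only propositionally equal, so their
  -- minors are matrices of different types and have to be compared along `cast`.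
  det-cast : ∀ {m n} (eq : m ≡ n) (A : Matrix Carrier m m) (B : Matrix Carrier n n) →
    (∀ i j → A i j ≈ B (cast eq i) (cast eq j)) → det A ≈ det B
  det-cast ≡.refl A B A≈B = det-cong λ i j → trans (A≈B i j)
    (reflexive (≡.cong₂ B (Fin.cast-is-id ≡.refl i) (Fin.cast-is-id ≡.refl j)))

  -- The entries outside `α` carry `x`, so `α` collects the indices that no term of the expansion
  -- can drop. This is why `det-shift` sums over the supersets of `α`.
  diag : ∀ {n} → Carrier → Subset n → Matrix Carrier n n
  diag x α i j = if does (i Fin.≟ j) ∧ not (lookup α i) then x else 0#

  shift : ∀ {n} → Carrier → Subset n → Matrix Carrier n n → Matrix Carrier n n
  shift x α A i j = A i j + diag x α i j

  diag-insertAt : ∀ {n} x (α : Subset n) p s →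
    diag x (insertAt α p s) p p ≈ (if not s then x else 0#)
  diag-insertAt x α p s rewrite Vec.insertAt-lookup α p s with p Fin.≟ p
  ... | yes _  = refl
  ... | no p≢p = contradiction ≡.refl p≢p

  diag-insertAt-≢ : ∀ {n} x (α : Subset n) p s s′ i j → i ≢ p ⊎ j ≢ p →
    diag x (insertAt α p s) i j ≈ diag x (insertAt α p s′) i j
  diag-insertAt-≢ x α p s s′ i j ≢p with i Fin.≟ j
  ... | no _ = refl
  ... | yes ≡.refl with p Fin.≟ i
  ...   | yes ≡.refl = contradiction ≡.refl (reduce ≢p)
  ...   | no p≢i = reflexive (≡.cong (λ b → if not b then x else 0#) (≡.trans (at s) (≡.sym (at s′))))
    where
    at : ∀ t → lookup (insertAt α p t) i ≡ lookup α (punchOut p≢i)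
    at t = ≡.trans (≡.cong (lookup (insertAt α p t)) (≡.sym (Fin.punchIn-punchOut p≢i)))
                   (Vec.insertAt-punchIn α p t (punchOut p≢i))

  diag-punchIn : ∀ {n} x (α : Subset n) p s i j →
    diag x (insertAt α p s) (punchIn p i) (punchIn p j) ≈ diag x α i j
  diag-punchIn x α p s i j rewrite Vec.insertAt-punchIn α p s i
    with i Fin.≟ j | punchIn p i Fin.≟ punchIn p j
  ... | yes _   | yes _   = refl
  ... | no _    | no _    = refl
  ... | yes i≡j | no ≢    = contradiction (≡.cong (punchIn p) i≡j) ≢
  ... | no i≢j  | yes eq  = contradiction (Fin.punchIn-injective p i j eq) i≢j

  -- Induction on the number of shifted entries: undoing the shift at p subtracts
  -- x times the minor at (p , p).
  det-shift : ∀ {n} x (α : Subset n) (A : Matrix Carrier n n) →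
    det (shift x α A) ≈ ∑ (supersets α) (λ β → x ^ ∣ ∁ β ∣ * det (principal A β))
  det-shift x α A = go ∣ ∁ α ∣ α A ≡.refl
    where
    -- `m` is the number of shifted entries; both recursive calls, with `p` added to the set and
    -- with `p` deleted from the index range, lower it by one.
    go : ∀ m {n} (α : Subset n) (A : Matrix Carrier n n) → ∣ ∁ α ∣ ≡ m →
      det (shift x α A) ≈ ∑ (supersets α) (λ β → x ^ ∣ ∁ β ∣ * det (principal A β))
    go m {n} α A eq with outsideView α
    go m {n} α A eq | none = begin
      det (shift x ⊤ A)         ≈⟨ det-cast (∣⊤∣ n) (shift x ⊤ A) (principal A ⊤) entry ⟩
      det (principal A ⊤)       ≈⟨ *-identityˡ _ ⟨
      1# * det (principal A ⊤)  ≈⟨ *-congʳ (^-congʳ x (≡.sym ∣∁⊤∣≡0)) ⟩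
      F ⊤                       ≈⟨ +-identityʳ _ ⟨
      ∑ (⊤ ∷ []) F              ≡⟨ ≡.cong (λ βs → ∑ βs F) (supersets-⊤ n) ⟨
      ∑ (supersets ⊤) F         ∎
      where
      F : Subset n → Carrier
      F β = x ^ ∣ ∁ β ∣ * det (principal A β)
      ∣∁⊤∣≡0 : ∣ ∁ (⊤ {n}) ∣ ≡ 0
      ∣∁⊤∣≡0 = ≡.trans (Sub.∣∁p∣≡n∸∣p∣ (⊤ {n})) (≡.trans (≡.cong (n ℕ.∸_) (Sub.∣⊤∣≡n n)) (ℕ.n∸n≡0 n))
      entry : ∀ i j → shift x ⊤ A i j ≈ principal A ⊤ (cast (∣⊤∣ n) i) (cast (∣⊤∣ n) j)
      entry i j rewrite enumerate-⊤ i | enumerate-⊤ j | lookup-⊤ i with i Fin.≟ j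
      ... | yes _ = +-identityʳ _
      ... | no  _ = +-identityʳ _
    go zero    α A eq | insert p α′ = contradiction (≡.trans (≡.sym (∣∁insertAt-outside∣ p α′)) eq) λ ()
    go (suc m) α A eq | insert p α′ = begin
      det (shift x (insertAt α′ p outside) A)
        ≈⟨ det-perturb B (shift x (insertAt α′ p outside) A) p p x
             (trans (+-congˡ (diag-insertAt x α′ p outside))
                    (+-congʳ (sym (trans (+-congˡ (diag-insertAt x α′ p inside)) (+-identityʳ _)))))
             (λ r s rs≢ → +-congˡ (diag-insertAt-≢ x α′ p outside inside r s rs≢)) ⟩
      det B + sign (toℕ p) * sign (toℕ p) * (x * det (minor p p B))
        -- The entry is on the diagonal, so the sign of its cofactor is a square.
        ≈⟨ +-congˡ (trans (*-congʳ (sign²≈1 (toℕ p))) (*-identityˡ _)) ⟩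
      det B + x * det (minor p p B)
        ≈⟨ +-cong (go m (insertAt α′ p inside) A (≡.trans (∣∁insertAt-inside∣ p α′) ∣∁α′∣≡m))
                  (*-congˡ (trans (det-cong λ i j → +-congˡ (diag-punchIn x α′ p inside i j))
                                  (go m α′ (minor p p A) ∣∁α′∣≡m))) ⟩
      ∑ (supersets (insertAt α′ p inside)) F + x * ∑ (supersets α′) G
        ≈⟨ +-congˡ (*-distribˡ-∑ (supersets α′) G x) ⟩
      ∑ (supersets (insertAt α′ p inside)) F + ∑ (supersets α′) (λ β → x * G β)
        ≈⟨ +-congˡ (∑-cong (supersets α′) xG≈F) ⟩
      ∑ (supersets (insertAt α′ p inside)) F + ∑ (supersets α′) (λ β → F (insertAt β p outside))
        ≈⟨ ∑-supersets-insertAt p α′ F ⟨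
      ∑ (supersets (insertAt α′ p outside)) F ∎
      where
      B : Matrix Carrier _ _
      B = shift x (insertAt α′ p inside) A
      F : Subset _ → Carrier
      F β = x ^ ∣ ∁ β ∣ * det (principal A β)
      G : Subset _ → Carrier
      G β = x ^ ∣ ∁ β ∣ * det (principal (minor p p A) β)
      -- The extra factor `x` is the contribution of `p`, which belongs to the complement of
      -- `insertAt β p outside` and is not an index of `β`.
      xG≈F : ∀ β → x * G β ≈ F (insertAt β p outside)
      xG≈F β = trans (sym (*-assoc x _ _)) (*-cong
        (^-congʳ x (≡.sym (∣∁insertAt-outside∣ p β)))
        (sym (det-cast (∣insertAt-outside∣ p β) (principal A (insertAt β p outside)) (principal (minor p p A) β)
          λ i j → reflexive (≡.cong₂ A (enumerate-insertAt-outside p β i) (enumerate-insertAt-outside p β j)))))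
      ∣∁α′∣≡m : ∣ ∁ α′ ∣ ≡ m
      ∣∁α′∣≡m = ℕ.suc-injective (≡.trans (≡.sym (∣∁insertAt-outside∣ p α′)) eq)

-- The characteristic polynomial

module RingHomomorphism {c ℓ c′ ℓ′} (R : CommutativeRing c ℓ) (S : CommutativeRing c′ ℓ′)
  (h : CommutativeRing.Carrier R → CommutativeRing.Carrier S)
  (isHom : IsRingHomomorphism (CommutativeRing.rawRing R) (CommutativeRing.rawRing S) h) where

  private
    module R where
      open CommutativeRing R public
      open LinearAlgebra rawRing using (det) public
      open Determinant R using (sign) public
      open import Algebra.Properties.Semiring.Sum semiring using (sum) public
    module S where
      open CommutativeRing S public
      open LinearAlgebra rawRing using (det) public
      open Determinant S using (sign) public
      open import Algebra.Properties.Semiring.Sum semiring using (sum; sum-cong-≋) public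
  open IsRingHomomorphism isHom using (+-homo; *-homo; 0#-homo; 1#-homo; -‿homo)

  sign-homo : ∀ n → h (R.sign n) S.≈ S.sign n
  sign-homo zero    = 1#-homo
  sign-homo (suc n) = S.trans (*-homo _ _) (S.*-cong (S.trans (-‿homo _) (S.-‿cong 1#-homo)) (sign-homo n))

  sum-homo : ∀ {n} (f : Fin n → R.Carrier) → h (R.sum f) S.≈ S.sum (h ∘ f)
  sum-homo {zero}  f = 0#-homo
  sum-homo {suc n} f = S.trans (+-homo _ _) (S.+-congˡ (sum-homo (f ∘ suc)))

  -- A determinant is an integer polynomial in the entries, hence compatible with ring
  -- homomorphisms. With `const` it identifies the minors of a matrix of constant polynomials.
  det-homo : ∀ {n} (B : Matrix R.Carrier n n) → h (R.det B) S.≈ S.det (λ i j → h (B i j))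
  det-homo {zero}  B = 1#-homo
  det-homo {suc n} B = S.trans
    (sum-homo (λ j → R.sign (toℕ j) R.* B zero j R.* R.det (minor zero j B)))
    (S.sum-cong-≋ λ j → S.trans (*-homo (R.sign (toℕ j) R.* B zero j) (R.det (minor zero j B)))
      (S.*-cong (S.trans (*-homo (R.sign (toℕ j)) (B zero j)) (S.*-congʳ (sign-homo (toℕ j))))
                (det-homo (minor zero j B))))

module CharacteristicPolynomial {c ℓ} (R : CommutativeRing c ℓ) where

  open CommutativeRing R hiding (_-_; zero)
  open LinearAlgebra rawRing using (det)
  open Polynomials rawRing
  open Determinant R
  open PrincipalMinors R
  open import Algebra.Properties.Semiring.Sum semiring using (sum; sum-cong-≋; *-distribˡ-sum)
  open import Algebra.Properties.Ring ring using (-1*x≈-x; -0#≈0#)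
  open import Algebra.Solver.Ring.NaturalCoefficients.Default commutativeSemiring
    using (solve; _:=_; _:*_; _:+_)
  open import Relation.Binary.Reasoning.Setoid setoid

  -- Coefficient sequences identify polynomials that differ by trailing zeros, so the
  -- ring laws of ⊛ are derived from those of convolution.
  conv : (ℕ → Carrier) → (ℕ → Carrier) → ℕ → Carrier
  conv f g zero    = f 0 * g 0
  conv f g (suc n) = f 0 * g (suc n) + conv (f ∘ suc) g n

  conv-cong : ∀ {f f′ g g′} → (∀ n → f n ≈ f′ n) → (∀ n → g n ≈ g′ n) → ∀ n → conv f g n ≈ conv f′ g′ n
  conv-cong f≈ g≈ zero    = *-cong (f≈ 0) (g≈ 0)
  conv-cong f≈ g≈ (suc n) = +-cong (*-cong (f≈ 0) (g≈ (suc n))) (conv-cong (f≈ ∘ suc) g≈ n)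

  conv-zeroˡ : ∀ {f} g → (∀ n → f n ≈ 0#) → ∀ n → conv f g n ≈ 0#
  conv-zeroˡ g f≈0 zero    = trans (*-congʳ (f≈0 0)) (zeroˡ (g 0))
  conv-zeroˡ g f≈0 (suc n) = trans
    (+-cong (trans (*-congʳ (f≈0 0)) (zeroˡ _)) (conv-zeroˡ g (f≈0 ∘ suc) n)) (+-identityˡ 0#)

  conv-distribʳ : ∀ f f′ g n → conv (λ i → f i + f′ i) g n ≈ conv f g n + conv f′ g n
  conv-distribʳ f f′ g zero    = distribʳ (g 0) (f 0) (f′ 0)
  conv-distribʳ f f′ g (suc n) = trans (+-congˡ (conv-distribʳ (f ∘ suc) (f′ ∘ suc) g n))
    (solve 5 (λ a b x p q → (a :+ b) :* x :+ (p :+ q) := a :* x :+ p :+ (b :* x :+ q)) refl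
      (f 0) (f′ 0) (g (suc n)) (conv (f ∘ suc) g n) (conv (f′ ∘ suc) g n))

  conv-* : ∀ a f g n → conv (λ i → a * f i) g n ≈ a * conv f g n
  conv-* a f g zero    = *-assoc a (f 0) (g 0)
  conv-* a f g (suc n) = trans (+-cong (*-assoc a (f 0) (g (suc n))) (conv-* a (f ∘ suc) g n))
    (sym (distribˡ a (f 0 * g (suc n)) (conv (f ∘ suc) g n)))

  -- `conv` recurses on the left factor; peeling the right factor instead is what the induction for
  -- commutativity needs.
  conv-sucʳ : ∀ f g n → conv f g (suc n) ≈ f (suc n) * g 0 + conv f (g ∘ suc) n
  conv-sucʳ f g zero    = +-comm (f 0 * g 1) (f 1 * g 0)
  conv-sucʳ f g (suc n) = trans (+-congˡ (conv-sucʳ (f ∘ suc) g n))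
    (solve 3 (λ a b c → a :+ (b :+ c) := b :+ (a :+ c)) refl
      (f 0 * g (suc (suc n))) (f (suc (suc n)) * g 0) (conv (f ∘ suc) (g ∘ suc) n))

  conv-comm : ∀ f g n → conv f g n ≈ conv g f n
  conv-comm f g zero    = *-comm (f 0) (g 0)
  conv-comm f g (suc n) = trans
    (+-cong (*-comm (f 0) (g (suc n))) (conv-comm (f ∘ suc) g n)) (sym (conv-sucʳ g f n))

  conv-assoc : ∀ f g h n → conv (conv f g) h n ≈ conv f (conv g h) n
  conv-assoc f g h zero    = *-assoc (f 0) (g 0) (h 0)
  conv-assoc f g h (suc n) = begin
    f 0 * g 0 * h (suc n) + conv (λ i → f 0 * g (suc i) + conv (f ∘ suc) g i) h n
      ≈⟨ +-congˡ (conv-distribʳ (λ i → f 0 * g (suc i)) (conv (f ∘ suc) g) h n) ⟩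
    f 0 * g 0 * h (suc n) + (conv (λ i → f 0 * g (suc i)) h n + conv (conv (f ∘ suc) g) h n)
      ≈⟨ +-congˡ (+-cong (conv-* (f 0) (g ∘ suc) h n) (conv-assoc (f ∘ suc) g h n)) ⟩
    f 0 * g 0 * h (suc n) + (f 0 * conv (g ∘ suc) h n + conv (f ∘ suc) (conv g h) n)
      ≈⟨ solve 5 (λ a b c d e → a :* b :* c :+ (a :* d :+ e) := a :* (b :* c :+ d) :+ e) refl
           (f 0) (g 0) (h (suc n)) (conv (g ∘ suc) h n) (conv (f ∘ suc) (conv g h) n) ⟩
    f 0 * conv g h (suc n) + conv (f ∘ suc) (conv g h) n ∎

  coeffs : Poly → ℕ → Carrier
  coeffs p n = coeff n p

  coeff-⊕ : ∀ p q n → coeff n (p ⊕ q) ≈ coeff n p + coeff n q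
  coeff-⊕ []      q       n       = sym (+-identityˡ _)
  coeff-⊕ (a ∷ p) []      n       = sym (+-identityʳ _)
  coeff-⊕ (a ∷ p) (b ∷ q) zero    = refl
  coeff-⊕ (a ∷ p) (b ∷ q) (suc n) = coeff-⊕ p q n

  coeff-map : ∀ f → f 0# ≈ 0# → ∀ p n → coeff n (map f p) ≈ f (coeff n p)
  coeff-map f f0≈0 []      n       = sym f0≈0
  coeff-map f f0≈0 (a ∷ p) zero    = refl
  coeff-map f f0≈0 (a ∷ p) (suc n) = coeff-map f f0≈0 p n

  coeff-⊛ : ∀ p q n → coeff n (p ⊛ q) ≈ conv (coeffs p) (coeffs q) n
  coeff-⊛ []      q n = sym (conv-zeroˡ (coeffs q) (λ _ → refl) n)
  coeff-⊛ (a ∷ p) q n = trans (coeff-⊕ (map (a *_) q) (0# ∷ (p ⊛ q)) n)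
    (trans (+-congʳ (coeff-map (a *_) (zeroʳ a) q n)) (tail n))
    where
    tail : ∀ n → a * coeff n q + coeff n (0# ∷ (p ⊛ q)) ≈ conv (coeffs (a ∷ p)) (coeffs q) n
    tail zero    = +-identityʳ _
    tail (suc n) = +-congˡ (coeff-⊛ p q n)

  -- The operations are literally those of `Poly-rawRing`, so results on determinants over a
  -- commutative ring speak about the determinant inside `charPoly` without any transport.
  polyRing : CommutativeRing c ℓ
  polyRing = record
    { Carrier = Poly
    ; _≈_     = λ p q → ∀ n → coeff n p ≈ coeff n q
    ; _+_     = _⊕_
    ; _*_     = _⊛_
    ; -_      = map -_
    ; 0#      = []
    ; 1#      = 1# ∷ []
    ; isCommutativeRing = record
      { isRing = record
        { +-isAbelianGroup = record
          { isGroup = record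
            { isMonoid = record
              { isSemigroup = record
                { isMagma = record
                  { isEquivalence = record
                    { refl  = λ _ → refl
                    ; sym   = λ p≈q n → sym (p≈q n)
                    ; trans = λ p≈q q≈r n → trans (p≈q n) (q≈r n)
                    }
                  ; ∙-cong = λ {p} {p′} {q} {q′} p≈ q≈ n →
                      trans (coeff-⊕ p q n) (trans (+-cong (p≈ n) (q≈ n)) (sym (coeff-⊕ p′ q′ n)))
                  }
                ; assoc = λ p q r n → begin
                    coeff n (p ⊕ q ⊕ r)                    ≈⟨ trans (coeff-⊕ (p ⊕ q) r n) (+-congʳ (coeff-⊕ p q n)) ⟩
                    coeff n p + coeff n q + coeff n r      ≈⟨ +-assoc _ _ _ ⟩
                    coeff n p + (coeff n q + coeff n r)    ≈⟨ trans (coeff-⊕ p (q ⊕ r) n) (+-congˡ (coeff-⊕ q r n)) ⟨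
                    coeff n (p ⊕ (q ⊕ r))                  ∎
                }
              ; identity = (λ _ _ → refl) , λ p n → trans (coeff-⊕ p [] n) (+-identityʳ _)
              }
            ; inverse = (λ p n → trans (coeff-⊕ (map -_ p) p n)
                          (trans (+-congʳ (coeff-map -_ -0#≈0# p n)) (-‿inverseˡ _)))
                      , (λ p n → trans (coeff-⊕ p (map -_ p) n)
                          (trans (+-congˡ (coeff-map -_ -0#≈0# p n)) (-‿inverseʳ _)))
            ; ⁻¹-cong = λ {p} {q} p≈q n → trans (coeff-map -_ -0#≈0# p n)
                (trans (-‿cong (p≈q n)) (sym (coeff-map -_ -0#≈0# q n)))
            }
          ; comm = λ p q n → trans (coeff-⊕ p q n) (trans (+-comm _ _) (sym (coeff-⊕ q p n)))
          }
        ; *-cong = λ {p} {p′} {q} {q′} p≈ q≈ n →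
            trans (coeff-⊛ p q n) (trans (conv-cong p≈ q≈ n) (sym (coeff-⊛ p′ q′ n)))
        ; *-assoc = λ p q r n → begin
            coeff n (p ⊛ q ⊛ r)
              ≈⟨ trans (coeff-⊛ (p ⊛ q) r n) (conv-cong (coeff-⊛ p q) (λ _ → refl) n) ⟩
            conv (conv (coeffs p) (coeffs q)) (coeffs r) n
              ≈⟨ conv-assoc (coeffs p) (coeffs q) (coeffs r) n ⟩
            conv (coeffs p) (conv (coeffs q) (coeffs r)) n
              ≈⟨ trans (coeff-⊛ p (q ⊛ r) n) (conv-cong (λ _ → refl) (coeff-⊛ q r) n) ⟨
            coeff n (p ⊛ (q ⊛ r)) ∎
        ; *-identity = ⊛-identityˡ , λ p n → trans (⊛-comm p (1# ∷ []) n) (⊛-identityˡ p n)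
        ; distrib = (λ p q r n → trans (⊛-comm p (q ⊕ r) n) (trans (⊛-distribʳ p q r n)
                      (trans (coeff-⊕ (q ⊛ p) (r ⊛ p) n)
                      (trans (+-cong (⊛-comm q p n) (⊛-comm r p n)) (sym (coeff-⊕ (p ⊛ q) (p ⊛ r) n))))))
                  , ⊛-distribʳ
        }
      ; *-comm = ⊛-comm
      }
    }
    where
    ⊛-comm : ∀ p q n → coeff n (p ⊛ q) ≈ coeff n (q ⊛ p)
    ⊛-comm p q n = trans (coeff-⊛ p q n) (trans (conv-comm (coeffs p) (coeffs q) n) (sym (coeff-⊛ q p n)))
    ⊛-distribʳ : ∀ p q r n → coeff n ((q ⊕ r) ⊛ p) ≈ coeff n (q ⊛ p ⊕ r ⊛ p)
    ⊛-distribʳ p q r n = begin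
      coeff n ((q ⊕ r) ⊛ p)                                            ≈⟨ coeff-⊛ (q ⊕ r) p n ⟩
      conv (coeffs (q ⊕ r)) (coeffs p) n                               ≈⟨ conv-cong (coeff-⊕ q r) (λ _ → refl) n ⟩
      conv (λ i → coeff i q + coeff i r) (coeffs p) n                  ≈⟨ conv-distribʳ (coeffs q) (coeffs r) (coeffs p) n ⟩
      conv (coeffs q) (coeffs p) n + conv (coeffs r) (coeffs p) n      ≈⟨ +-cong (coeff-⊛ q p n) (coeff-⊛ r p n) ⟨
      coeff n (q ⊛ p) + coeff n (r ⊛ p)                                ≈⟨ coeff-⊕ (q ⊛ p) (r ⊛ p) n ⟨
      coeff n (q ⊛ p ⊕ r ⊛ p)                                          ∎
    ⊛-identityˡ : ∀ p n → coeff n ((1# ∷ []) ⊛ p) ≈ coeff n p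
    ⊛-identityˡ p n = trans (coeff-⊛ (1# ∷ []) p n) (one n)
      where
      one : ∀ n → conv (coeffs (1# ∷ [])) (coeffs p) n ≈ coeff n p
      one zero    = *-identityˡ _
      one (suc n) = trans (+-cong (*-identityˡ _) (conv-zeroˡ (coeffs p) (λ _ → refl) n)) (+-identityʳ _)

  module P where
    open CommutativeRing polyRing public
    open LinearAlgebra Poly-rawRing using (det; I) public
    open Determinant polyRing using (sign; det-cong) public
    open PrincipalMinors polyRing public
    open import Algebra.Properties.Semiring.Exp (CommutativeRing.semiring polyRing) using (_^_) public
    open import Algebra.Properties.Semiring.Sum (CommutativeRing.semiring polyRing) using (sum; sum-cong-≋) public

  const-cong : ∀ {a b} → a ≈ b → const a P.≈ const b
  const-cong a≈b zero    = a≈b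
  const-cong a≈b (suc n) = refl

  const-* : ∀ a b → const a ⊛ const b P.≈ const (a * b)
  const-* a b zero    = +-identityʳ (a * b)
  const-* a b (suc n) = refl

  const-0 : P.0# P.≈ const 0#
  const-0 zero    = refl
  const-0 (suc n) = refl

  const-isRingHomomorphism : IsRingHomomorphism rawRing P.rawRing const
  const-isRingHomomorphism = record
    { isSemiringHomomorphism = record
      { isNearSemiringHomomorphism = record
        { +-isMonoidHomomorphism = record
          { isMagmaHomomorphism = record
            { isRelHomomorphism = record { cong = const-cong }
            ; homo              = λ _ _ _ → refl
            }
          ; ε-homo = P.sym {P.0#} {const 0#} const-0
          }
        ; *-homo = λ a b → P.sym {const a ⊛ const b} {const (a * b)} (const-* a b)
        }
      ; 1#-homo = λ _ → refl
      }
    ; -‿homo = λ _ _ → refl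
    }

  det-const : ∀ {n} (B : Matrix Carrier n n) → P.det (λ i j → const (B i j)) P.≈ const (det B)
  det-const B = P.sym {const (det B)} {P.det (λ i j → const (B i j))}
    (RingHomomorphism.det-homo R polyRing const const-isRingHomomorphism B)

  det-neg : ∀ {n} (B : Matrix Carrier n n) → det (λ i j → - B i j) ≈ sign n * det B
  det-neg {zero}  B = sym (*-identityˡ 1#)
  det-neg {suc n} B = trans (sum-cong-≋ λ j → begin
    sign (toℕ j) * - B zero j * det (λ r s → - minor zero j B r s)
      ≈⟨ *-cong (*-congˡ (sym (-1*x≈-x (B zero j)))) (det-neg (minor zero j B)) ⟩
    sign (toℕ j) * (- 1# * B zero j) * (sign n * det (minor zero j B))
      ≈⟨ solve 5 (λ s m b t d → s :* (m :* b) :* (t :* d) := m :* t :* (s :* b :* d)) refl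
           _ (- 1#) (B zero j) (sign n) (det (minor zero j B)) ⟩
    sign (suc n) * (sign (toℕ j) * B zero j * det (minor zero j B)) ∎)
    (sym (*-distribˡ-sum (sign (suc n)) (λ j → sign (toℕ j) * B zero j * det (minor zero j B))))

  coeff-X^⊛const : ∀ j a m → coeff m (X P.^ j ⊛ const a) ≈ (if does (m ℕ.≟ j) then a else 0#)
  coeff-X^⊛const zero    a zero    = P.*-identityˡ (const a) 0
  coeff-X^⊛const zero    a (suc m) = P.*-identityˡ (const a) (suc m)
  coeff-X^⊛const (suc j) a m = trans (P.*-assoc X (X P.^ j) (const a) m)
    (trans (coeff-⊛ X q m) (X-shift m))
    where
    q = X P.^ j ⊛ const a
    X-shift : ∀ m → conv (coeffs X) (coeffs q) m ≈ (if does (m ℕ.≟ suc j) then a else 0#)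
    X-shift zero    = zeroˡ _
    X-shift (suc m) = trans
      (+-cong (zeroˡ (coeff (suc m) q)) (trans (sym (coeff-⊛ P.1# q m)) (P.*-identityˡ q m)))
      (trans (+-identityˡ (coeff m q)) (coeff-X^⊛const j a m))

  charPolyTerm : ∀ {n} → Matrix Carrier n n → Subset n → Poly
  charPolyTerm B β = X P.^ ∣ ∁ β ∣ ⊛ const (sign ∣ β ∣ * det (principal B β))

  -- `xI - B` is the constant matrix `- B` shifted by `X` along the whole diagonal, that is, outside
  -- `⊥`. So `det-shift` over the polynomials applies, and the minors of `- B` contribute the signs.
  charPoly-expansion : ∀ {n} (B : Matrix Carrier n n) → charPoly B P.≈ P.∑ (subsets n) (charPolyTerm B)
  charPoly-expansion {n} B = P≈.begin
    charPoly B
      P≈.≈⟨ P.det-cong entry ⟩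
    P.det (P.shift X ⊥ N)
      P≈.≈⟨ P.det-shift X ⊥ N ⟩
    P.∑ (subsets n) (λ β → X P.^ ∣ ∁ β ∣ ⊛ P.det (principal N β))
      P≈.≈⟨ P.∑-cong (subsets n) (λ β →
              P.*-congˡ {x = X P.^ ∣ ∁ β ∣} {P.det (principal N β)} {const (sign ∣ β ∣ * det (principal B β))} (minor≈ β)) ⟩
    P.∑ (subsets n) (charPolyTerm B) P≈.∎
    where
    module P≈ = Relation.Binary.Reasoning.Setoid P.setoid
    N : Matrix Poly n n
    N i j = const (- B i j)
    minor≈ : ∀ β → P.det (principal N β) P.≈ const (sign ∣ β ∣ * det (principal B β))
    minor≈ β = P.trans {P.det (principal N β)} {const (det (λ i j → - principal B β i j))}
                       {const (sign ∣ β ∣ * det (principal B β))}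
      (det-const (λ i j → - principal B β i j)) (const-cong (det-neg (principal B β)))
    entry : ∀ i j → X ⊛ P.I n i j ⊕ N i j P.≈ P.shift X ⊥ N i j
    entry i j = P.trans {X ⊛ P.I n i j ⊕ N i j} {N i j ⊕ X ⊛ P.I n i j} {P.shift X ⊥ N i j}
      (P.+-comm (X ⊛ P.I n i j) (N i j))
      (P.+-congˡ {x = N i j} {X ⊛ P.I n i j} {P.diag X ⊥ i j} diagonal)
      where
      diagonal : X ⊛ P.I n i j P.≈ P.diag X ⊥ i j
      diagonal rewrite Vec.lookup-replicate i outside with does (i Fin.≟ j)
      ... | true  = P.*-identityʳ X
      ... | false = P.zeroʳ X

  coeff-∑ : ∀ {a} {Y : Set a} (ys : List Y) f m → coeff m (P.∑ ys f) ≈ ∑ ys (λ y → coeff m (f y))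
  coeff-∑ []       f m = refl
  coeff-∑ (y ∷ ys) f m = trans (coeff-⊕ (f y) (P.∑ ys f) m) (+-congˡ (coeff-∑ ys f m))

  -- The size condition sits in the summand, so that all sums run over `subsets n` and split by the
  -- same recursion. Over ℂ this is the `k`-th elementary symmetric polynomial of the eigenvalues.
  minorSum : ∀ {n} → Matrix Carrier n n → ℕ → Carrier
  minorSum {n} B k = ∑ (subsets n) (λ β → if does (∣ β ∣ ℕ.≟ k) then det (principal B β) else 0#)

  -- For `k ≤ n` the terms of degree `n - k` are those with `∣ β ∣ ≡ k`, all of sign `sign k`. For
  -- `k > n` both sides vanish: the exponent is negative and no subset is that large.
  coeff-charPoly : ∀ {n} (B : Matrix Carrier n n) k →
    coeffℤ (ℤ.+ n ℤ.- ℤ.+ k) (charPoly B) ≈ sign k * minorSum B k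
  coeff-charPoly {n} B k with k ℕ.≤? n
  ... | yes k≤n rewrite ℤ.m-n≡m⊖n n k | ℤ.⊖-≥ k≤n = begin
    coeff (n ℕ.∸ k) (charPoly B)
      ≈⟨ charPoly-expansion B (n ℕ.∸ k) ⟩
    coeff (n ℕ.∸ k) (P.∑ (subsets n) (charPolyTerm B))
      ≈⟨ coeff-∑ (subsets n) (charPolyTerm B) (n ℕ.∸ k) ⟩
    ∑ (subsets n) (λ β → coeff (n ℕ.∸ k) (charPolyTerm B β))
      ≈⟨ ∑-cong (subsets n) (λ β → trans (coeff-X^⊛const ∣ ∁ β ∣ _ (n ℕ.∸ k)) (select β)) ⟩
    ∑ (subsets n) (λ β → sign k * (if does (∣ β ∣ ℕ.≟ k) then det (principal B β) else 0#))
      ≈⟨ *-distribˡ-∑ (subsets n) (λ β → if does (∣ β ∣ ℕ.≟ k) then det (principal B β) else 0#) (sign k) ⟨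
    sign k * minorSum B k ∎
    where
    select : ∀ β → (if does (n ℕ.∸ k ℕ.≟ ∣ ∁ β ∣) then sign ∣ β ∣ * det (principal B β) else 0#)
      ≈ sign k * (if does (∣ β ∣ ℕ.≟ k) then det (principal B β) else 0#)
    select β with ∣ β ∣ ℕ.≟ k
    ... | yes ≡.refl
      rewrite dec-true (∣ β ∣ ℕ.≟ ∣ β ∣) ≡.refl
            | dec-true (n ℕ.∸ ∣ β ∣ ℕ.≟ ∣ ∁ β ∣) (≡.sym (Sub.∣∁p∣≡n∸∣p∣ β)) = refl
    ... | no ≢k
      rewrite dec-false (∣ β ∣ ℕ.≟ k) ≢k
            | dec-false (n ℕ.∸ k ℕ.≟ ∣ ∁ β ∣) (λ eq → ≢k
                (ℕ.∸-cancelˡ-≡ (Sub.∣p∣≤n β) k≤n (≡.trans (≡.sym (Sub.∣∁p∣≡n∸∣p∣ β)) (≡.sym eq)))) = sym (zeroʳ _)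
  ... | no k≰n rewrite ℤ.m-n≡m⊖n n k | ℤ.⊖-< (ℕ.≰⇒> k≰n) with k ℕ.∸ n in eq
  -- The exponent is minus `k ∸ n`, which becomes a negative integer, with coefficient zero, only
  -- after `k ∸ n` is seen to be a successor.
  ...   | zero  = contradiction (ℕ.m∸n≡0⇒m≤n eq) k≰n
  ...   | suc _ = sym (trans (*-congˡ (∑-zero (subsets n) _ empty)) (zeroʳ _))
    where
    empty : ∀ β → (if does (∣ β ∣ ℕ.≟ k) then det (principal B β) else 0#) ≈ 0#
    empty β rewrite dec-false (∣ β ∣ ℕ.≟ k) (λ { ≡.refl → k≰n (Sub.∣p∣≤n β) }) = refl

-- Counting subsets

∈-supersets⁺ : ∀ {n} {α β : Subset n} → α ⊆ β → β ∈ supersets α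
∈-supersets⁺ {α = []} {[]} _ = here ≡.refl
∈-supersets⁺ {α = inside ∷ α} {b ∷ β} α⊆β with α⊆β {zero} Vec.here
... | Vec.here = List.∈-map⁺ (inside ∷_) (∈-supersets⁺ (Sub.drop-∷-⊆ α⊆β))
∈-supersets⁺ {α = outside ∷ α} {inside ∷ β} α⊆β =
  List.∈-++⁺ˡ (List.∈-map⁺ (inside ∷_) (∈-supersets⁺ (Sub.drop-∷-⊆ α⊆β)))
∈-supersets⁺ {α = outside ∷ α} {outside ∷ β} α⊆β =
  List.∈-++⁺ʳ (map (inside ∷_) (supersets α)) (List.∈-map⁺ (outside ∷_) (∈-supersets⁺ (Sub.drop-∷-⊆ α⊆β)))

∈-supersets⁻ : ∀ {n} {α β : Subset n} → β ∈ supersets α → α ⊆ β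
∈-supersets⁻ {α = []} (here ≡.refl) = Sub.⊆-refl
∈-supersets⁻ {α = inside ∷ α} β∈ with List.∈-map⁻ (inside ∷_) β∈
... | β′ , β′∈ , ≡.refl = Sub.s⊆s (∈-supersets⁻ β′∈)
∈-supersets⁻ {α = outside ∷ α} β∈ with List.∈-++⁻ (map (inside ∷_) (supersets α)) β∈
... | inj₁ β∈ˡ with β′ , β′∈ , ≡.refl ← List.∈-map⁻ (inside ∷_) β∈ˡ = Sub.out⊆ (∈-supersets⁻ β′∈)
... | inj₂ β∈ʳ with β′ , β′∈ , ≡.refl ← List.∈-map⁻ (outside ∷_) β∈ʳ = Sub.out⊆ (∈-supersets⁻ β′∈)

supersets-unique : ∀ {n} (α : Subset n) → Unique (supersets α)
supersets-unique []            = All.[] AllPairs.∷ AllPairs.[]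
supersets-unique (inside  ∷ α) = Unique.map⁺ Vec.∷-injectiveʳ (supersets-unique α)
supersets-unique (outside ∷ α) = Unique.++⁺
  (Unique.map⁺ Vec.∷-injectiveʳ (supersets-unique α)) (Unique.map⁺ Vec.∷-injectiveʳ (supersets-unique α))
  λ (p , q) → disjoint (List.∈-map⁻ (inside ∷_) p) (List.∈-map⁻ (outside ∷_) q)
  where
  disjoint : ∀ {β} →
    ∃[ β′ ] β′ ∈ supersets α × β ≡ inside ∷ β′ → ¬ (∃[ β′ ] β′ ∈ supersets α × β ≡ outside ∷ β′)
  disjoint (_ , _ , ≡.refl) (_ , _ , ())

-- Duplicate-free lists with the same members are permutations of each other. This identifies the
-- numbers supplied by a given design with lengths of filtered lists.
HasSize-unique : ∀ {a ℓ} {X : Set a} {P : Pred X ℓ} {m n} → HasSize P m → HasSize P n → m ≡ n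
HasSize-unique (xs , xs! , ∈xs⇔P , ≡.refl) (ys , ys! , ∈ys⇔P , ≡.refl) =
  ↭-length (∼bag⇒↭ (unique∧set⇒bag xs! ys! λ {x} → ⇔-sym (∈ys⇔P x) ⇔-∘ ∈xs⇔P x))

HasSize-supersets : ∀ {n} {ℓ} {P : Pred (Subset n) ℓ} (P? : Decidable P) (α : Subset n) →
  HasSize (λ β → P β × α ⊆ β) (length (filter P? (supersets α)))
HasSize-supersets {P = P} P? α =
  filter P? (supersets α) , Unique.filter⁺ P? (supersets-unique α) , (λ β → mk⇔ (to β) (from β)) , ≡.refl
  where
  to : ∀ β → β ∈ filter P? (supersets α) → P β × α ⊆ β
  to β β∈ = proj₂ (List.∈-filter⁻ P? {xs = supersets α} β∈) , ∈-supersets⁻ (proj₁ (List.∈-filter⁻ P? β∈))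
  from : ∀ β → P β × α ⊆ β → β ∈ filter P? (supersets α)
  from β p = List.∈-filter⁺ P? (∈-supersets⁺ {α = α} {β} (proj₂ p)) (proj₁ p)

HasSize-resp-⇔ : ∀ {a ℓ ℓ′} {X : Set a} {P : Pred X ℓ} {Q : Pred X ℓ′} {m} →
  (∀ x → P x ⇔ Q x) → HasSize P m → HasSize Q m
HasSize-resp-⇔ P⇔Q (xs , xs! , ∈xs⇔P , eq) = xs , xs! , (λ x → P⇔Q x ⇔-∘ ∈xs⇔P x) , eq

-- A Boolean inclusion that computes by recursion, so that indicator sums over all subsets can be
-- compared summand by summand.
contains : ∀ {n} → Subset n → Subset n → Bool
contains []            []      = true
contains (inside  ∷ α) (b ∷ β) = b ∧ contains α β
contains (outside ∷ α) (_ ∷ β) = contains α β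

contains-⊥ : ∀ {n} (β : Subset n) → contains ⊥ β ≡ true
contains-⊥ []      = ≡.refl
contains-⊥ (b ∷ β) = contains-⊥ β

contains-⁅⁆ : ∀ {n} (x : Fin n) β → contains ⁅ x ⁆ β ≡ lookup β x
contains-⁅⁆ zero    (b ∷ β) = ≡.trans (≡.cong (b ∧_) (contains-⊥ β)) (Bool.∧-identityʳ b)
contains-⁅⁆ (suc x) (b ∷ β) = contains-⁅⁆ x β

contains-∪ : ∀ {n} (α α′ β : Subset n) → contains (α ∪ α′) β ≡ contains α β ∧ contains α′ β
contains-∪ []            []             []            = ≡.refl
contains-∪ (inside  ∷ α) (inside  ∷ α′) (inside  ∷ β) = contains-∪ α α′ β
contains-∪ (inside  ∷ α) (inside  ∷ α′) (outside ∷ β) = ≡.refl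
contains-∪ (inside  ∷ α) (outside ∷ α′) (inside  ∷ β) = contains-∪ α α′ β
contains-∪ (inside  ∷ α) (outside ∷ α′) (outside ∷ β) = ≡.refl
contains-∪ (outside ∷ α) (inside  ∷ α′) (inside  ∷ β) = contains-∪ α α′ β
contains-∪ (outside ∷ α) (inside  ∷ α′) (outside ∷ β) = ≡.sym (Bool.∧-zeroʳ (contains α β))
contains-∪ (outside ∷ α) (outside ∷ α′) (b       ∷ β) = contains-∪ α α′ β

∣⁅x⁆∪⁅y⁆∣≡2 : ∀ {n} {x y : Fin n} → x ≢ y → ∣ ⁅ x ⁆ ∪ ⁅ y ⁆ ∣ ≡ 2
∣⁅x⁆∪⁅y⁆∣≡2 {x = zero}  {zero}  x≢y = contradiction ≡.refl x≢y
∣⁅x⁆∪⁅y⁆∣≡2 {x = zero}  {suc y} x≢y = ≡.cong suc (≡.trans (≡.cong ∣_∣ (Sub.∪-identityˡ ⁅ y ⁆)) (Sub.∣⁅x⁆∣≡1 y))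
∣⁅x⁆∪⁅y⁆∣≡2 {x = suc x} {zero}  x≢y = ≡.cong suc (≡.trans (≡.cong ∣_∣ (Sub.∪-identityʳ ⁅ x ⁆)) (Sub.∣⁅x⁆∣≡1 x))
∣⁅x⁆∪⁅y⁆∣≡2 {x = suc x} {suc y} x≢y = ∣⁅x⁆∪⁅y⁆∣≡2 (x≢y ∘ ≡.cong suc)

⁅⁆⊆⇔∈ : ∀ {n} {x : Fin n} {β} → ⁅ x ⁆ ⊆ β ⇔ x ∈ₛ β
⁅⁆⊆⇔∈ {x = x} {β} = mk⇔ (λ x⊆β → x⊆β (Sub.x∈⁅x⁆ x)) to
  where
  to : x ∈ₛ β → ⁅ x ⁆ ⊆ β
  to x∈β y∈⁅x⁆ = ≡.subst (_∈ₛ β) (≡.sym (Sub.x∈⁅y⁆⇒x≡y x y∈⁅x⁆)) x∈β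

⁅⁆∪⁅⁆⊆⇔∈×∈ : ∀ {n} {x y : Fin n} {β} → ⁅ x ⁆ ∪ ⁅ y ⁆ ⊆ β ⇔ (x ∈ₛ β × y ∈ₛ β)
⁅⁆∪⁅⁆⊆⇔∈×∈ {x = x} {y} {β} = mk⇔
  (λ xy⊆β → xy⊆β (Sub.p⊆p∪q ⁅ y ⁆ (Sub.x∈⁅x⁆ x)) , xy⊆β (Sub.q⊆p∪q ⁅ x ⁆ ⁅ y ⁆ (Sub.x∈⁅x⁆ y))) to
  where
  to : x ∈ₛ β × y ∈ₛ β → ⁅ x ⁆ ∪ ⁅ y ⁆ ⊆ β
  to (x∈β , y∈β) z∈ with Sub.x∈p∪q⁻ ⁅ x ⁆ ⁅ y ⁆ z∈
  ... | inj₁ z∈⁅x⁆ = Equivalence.from ⁅⁆⊆⇔∈ x∈β z∈⁅x⁆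
  ... | inj₂ z∈⁅y⁆ = Equivalence.from ⁅⁆⊆⇔∈ y∈β z∈⁅y⁆

HasSize-positive : ∀ {a ℓ} {X : Set a} {P : Pred X ℓ} {n x} → P x → HasSize P n → 0 ℕ.< n
HasSize-positive {x = x} Px ([]     , _ , ∈⇔P , _)      = contradiction (Equivalence.from (∈⇔P x) Px) λ ()
HasSize-positive         Px (_ ∷ _ , _ , _   , ≡.refl) = ℕ.z<s

-- The image of a set of positions under `enumerate γ`. It turns a minor of the submatrix on `γ`
-- into a minor of the whole matrix.
within : ∀ {n} (γ : Subset n) → Subset ∣ γ ∣ → Subset n
within []            []      = []
within (inside  ∷ γ) (b ∷ β) = b ∷ within γ β
within (outside ∷ γ) β       = outside ∷ within γ β

∣within∣ : ∀ {n} (γ : Subset n) β → ∣ within γ β ∣ ≡ ∣ β ∣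
∣within∣ []            []            = ≡.refl
∣within∣ (inside  ∷ γ) (inside  ∷ β) = ≡.cong suc (∣within∣ γ β)
∣within∣ (inside  ∷ γ) (outside ∷ β) = ∣within∣ γ β
∣within∣ (outside ∷ γ) β             = ∣within∣ γ β

enumerate-within : ∀ {n} (γ : Subset n) β i →
  enumerate (within γ β) i ≡ enumerate γ (enumerate β (cast (∣within∣ γ β) i))
enumerate-within []            []            ()
enumerate-within (inside  ∷ γ) (inside  ∷ β) zero    = ≡.refl
enumerate-within (inside  ∷ γ) (inside  ∷ β) (suc i) = ≡.cong suc (enumerate-within γ β i)
enumerate-within (inside  ∷ γ) (outside ∷ β) i       = ≡.cong suc (enumerate-within γ β i)
enumerate-within (outside ∷ γ) β             i       = ≡.cong suc (enumerate-within γ β i)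

-- Sums of principal minors containing or avoiding given indices

module Counting {c ℓ} (R : CommutativeRing c ℓ) where

  open CommutativeRing R hiding (_-_; zero)
  open LinearAlgebra rawRing using (det)
  open Polynomials rawRing using (coeffℤ; charPoly)
  open Determinant R
  open PrincipalMinors R
  open CharacteristicPolynomial R using (minorSum; coeff-charPoly)
  open import Algebra.Properties.Ring ring using (-‿distribˡ-*; -‿involutive; -‿+-comm)
  open import Algebra.Properties.Semiring.Mult semiring using (×-homo-+) renaming (_×_ to _×ᴿ_)
  open import Algebra.Solver.Ring.NaturalCoefficients.Default commutativeSemiring
    using (solve; _:=_; _:*_; _:+_; con)
  open import Relation.Binary.Reasoning.Setoid setoid

  infixl 6 _-_
  _-_ : Carrier → Carrier → Carrier
  x - y = x + - y

  fromℕ : ℕ → Carrier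
  fromℕ n = n ×ᴿ 1#

  -- Moves the sum to the index list `subsets n`, common to all `α`, on which inclusion-exclusion
  -- can be checked pointwise.
  ∑-contains : ∀ {n} (α : Subset n) f →
    ∑ (supersets α) f ≈ ∑ (subsets n) (λ β → if contains α β then f β else 0#)
  ∑-contains []            f = refl
  ∑-contains {suc n} (inside  ∷ α) f = begin
    ∑ (supersets (inside ∷ α)) f
      ≈⟨ ∑-supersets-inside α f ⟩
    ∑ (supersets α) (f ∘ (inside ∷_))
      ≈⟨ ∑-contains α (f ∘ (inside ∷_)) ⟩
    ∑ (subsets n) (λ β → if contains α β then f (inside ∷ β) else 0#)
      ≈⟨ trans (+-congˡ (∑-zero (subsets n) (λ _ → 0#) (λ _ → refl))) (+-identityʳ _) ⟨
    ∑ (subsets n) (λ β → if contains α β then f (inside ∷ β) else 0#) + ∑ (subsets n) (λ _ → 0#)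
      ≈⟨ ∑-supersets-outside (⊥ {n}) (λ β → if contains (inside ∷ α) β then f β else 0#) ⟨
    ∑ (subsets (suc n)) (λ β → if contains (inside ∷ α) β then f β else 0#) ∎
  ∑-contains {suc n} (outside ∷ α) f = begin
    ∑ (supersets (outside ∷ α)) f
      ≈⟨ ∑-supersets-outside α f ⟩
    ∑ (supersets α) (f ∘ (inside ∷_)) + ∑ (supersets α) (f ∘ (outside ∷_))
      ≈⟨ +-cong (∑-contains α (f ∘ (inside ∷_))) (∑-contains α (f ∘ (outside ∷_))) ⟩
    _
      ≈⟨ ∑-supersets-outside (⊥ {n}) (λ β → if contains (outside ∷ α) β then f β else 0#) ⟨
    ∑ (subsets (suc n)) (λ β → if contains (outside ∷ α) β then f β else 0#) ∎

  -- `within (∁ α)` runs once through the subsets disjoint from `α`, which are the `β` whose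
  -- complement contains `α`.
  ∑-within-∁ : ∀ {n} (α : Subset n) f →
    ∑ (subsets ∣ ∁ α ∣) (f ∘ within (∁ α)) ≈
    ∑ (subsets n) (λ β → if contains α (∁ β) then f β else 0#)
  ∑-within-∁ []            f = refl
  ∑-within-∁ {suc n} (inside  ∷ α) f = begin
    ∑ (subsets ∣ ∁ α ∣) (f ∘ (outside ∷_) ∘ within (∁ α))
      ≈⟨ ∑-within-∁ α (f ∘ (outside ∷_)) ⟩
    ∑ (subsets n) (λ β → if contains α (∁ β) then f (outside ∷ β) else 0#)
      ≈⟨ trans (+-congʳ (∑-zero (subsets n) (λ _ → 0#) (λ _ → refl))) (+-identityˡ _) ⟨
    ∑ (subsets n) (λ _ → 0#) + ∑ (subsets n) (λ β → if contains α (∁ β) then f (outside ∷ β) else 0#)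
      ≈⟨ ∑-supersets-outside (⊥ {n}) (λ β → if contains (inside ∷ α) (∁ β) then f β else 0#) ⟨
    ∑ (subsets (suc n)) (λ β → if contains (inside ∷ α) (∁ β) then f β else 0#) ∎
  ∑-within-∁ {suc n} (outside ∷ α) f = begin
    ∑ (subsets ∣ ∁ (outside ∷ α) ∣) (f ∘ within (∁ (outside ∷ α)))
      ≈⟨ ∑-supersets-outside (⊥ {∣ ∁ α ∣}) (f ∘ within (∁ (outside ∷ α))) ⟩
    _
      ≈⟨ +-cong (∑-within-∁ α (f ∘ (inside ∷_))) (∑-within-∁ α (f ∘ (outside ∷_))) ⟩
    _
      ≈⟨ ∑-supersets-outside (⊥ {n}) (λ β → if contains (outside ∷ α) (∁ β) then f β else 0#) ⟨
    ∑ (subsets (suc n)) (λ β → if contains (outside ∷ α) (∁ β) then f β else 0#) ∎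

  fromℕ-length-filter : ∀ {a ℓ} {X : Set a} {P : Pred X ℓ} (P? : Decidable P) xs →
    fromℕ (length (filter P? xs)) ≈ ∑ xs (λ x → if does (P? x) then 1# else 0#)
  fromℕ-length-filter P? []       = refl
  fromℕ-length-filter P? (x ∷ xs) with does (P? x)
  ... | true  = +-congˡ (fromℕ-length-filter P? xs)
  ... | false = trans (fromℕ-length-filter P? xs) (sym (+-identityˡ _))

  sizeCount : ∀ {n} → Subset n → ℕ → Carrier
  sizeCount α k = ∑ (supersets α) (λ β → if does (∣ β ∣ ℕ.≟ k) then 1# else 0#)

  sizeCount-inside-zero : ∀ {n} (α : Subset n) →
    ∑ (supersets α) (λ β → if does (suc ∣ β ∣ ℕ.≟ 0) then 1# else 0#) ≈ 0#
  sizeCount-inside-zero α = ∑-zero (supersets α) (λ _ → 0#) (λ _ → refl)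

  sizeCount-< : ∀ {n} (α : Subset n) {k} → k ℕ.< ∣ α ∣ → sizeCount α k ≈ 0#
  sizeCount-< (inside  ∷ α) {zero}  k<α = trans (∑-supersets-inside α _) (sizeCount-inside-zero α)
  sizeCount-< (inside  ∷ α) {suc k} k<α = trans (∑-supersets-inside α _) (sizeCount-< α (ℕ.s<s⁻¹ k<α))
  sizeCount-< (outside ∷ α) {zero}  k<α = trans (∑-supersets-outside α _)
    (trans (+-cong (sizeCount-inside-zero α) (sizeCount-< α k<α)) (+-identityˡ 0#))
  sizeCount-< (outside ∷ α) {suc k} k<α = trans (∑-supersets-outside α _)
    (trans (+-cong (sizeCount-< α (ℕ.<-trans (ℕ.n<1+n k) k<α)) (sizeCount-< α k<α)) (+-identityˡ 0#))

  -- Every index outside `α` may join or stay out; splitting on the first of them is Pascal's rule.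
  -- Writing the size as `∣ α ∣ + m` keeps subtraction out of the induction.
  sizeCount-+ : ∀ {n} (α : Subset n) m → sizeCount α (∣ α ∣ ℕ.+ m) ≈ fromℕ (∣ ∁ α ∣ C m)
  sizeCount-+ []            zero    = refl
  sizeCount-+ []            (suc m) = +-identityˡ 0#
  sizeCount-+ (inside  ∷ α) m       = trans (∑-supersets-inside α _) (sizeCount-+ α m)
  sizeCount-+ (outside ∷ α) zero    = trans (∑-supersets-outside α _)
    (trans (+-cong (few ∣ α ∣ ≡.refl) (sizeCount-+ α zero)) (+-identityˡ _))
    where
    -- With `a` in place of `∣ α ∣`, a case split makes the test `suc ∣ β ∣ ≟ a + 0` compute. Once
    -- an outside index has joined, only a superset of `α` smaller than `α` would fit.
    few : ∀ a → a ≡ ∣ α ∣ →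
      ∑ (supersets α) (λ β → if does (suc ∣ β ∣ ℕ.≟ a ℕ.+ 0) then 1# else 0#) ≈ 0#
    few zero    eq = sizeCount-inside-zero α
    few (suc a) eq = sizeCount-< α (≡.subst (_ ℕ.<_) eq (ℕ.s≤s (ℕ.≤-reflexive (ℕ.+-identityʳ a))))
  sizeCount-+ (outside ∷ α) (suc m) = begin
    sizeCount (outside ∷ α) (∣ α ∣ ℕ.+ suc m)
      ≈⟨ ∑-supersets-outside α _ ⟩
    ∑ (supersets α) (λ β → if does (suc ∣ β ∣ ℕ.≟ ∣ α ∣ ℕ.+ suc m) then 1# else 0#) + rest
      ≡⟨ ≡.cong (λ t → ∑ (supersets α) (λ β → if does (suc ∣ β ∣ ℕ.≟ t) then 1# else 0#) + rest)
           (ℕ.+-suc ∣ α ∣ m) ⟩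
    sizeCount α (∣ α ∣ ℕ.+ m) + rest
      ≈⟨ +-cong (sizeCount-+ α m) (sizeCount-+ α (suc m)) ⟩
    fromℕ (∣ ∁ α ∣ C m) + fromℕ (∣ ∁ α ∣ C suc m)
      ≈⟨ ×-homo-+ 1# (∣ ∁ α ∣ C m) (∣ ∁ α ∣ C suc m) ⟨
    fromℕ (∣ ∁ α ∣ C m ℕ.+ ∣ ∁ α ∣ C suc m)
      ≡⟨ ≡.cong fromℕ (nCk+nC[k+1]≡[n+1]C[k+1] ∣ ∁ α ∣ m) ⟩
    fromℕ (∣ ∁ (outside ∷ α) ∣ C suc m) ∎
    where rest = sizeCount α (∣ α ∣ ℕ.+ suc m)

  -- If `k` is below `∣ α ∣`, the lower argument is a negative integer and `binom` is zero, as it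
  -- should be: no `k`-subset contains `α`. For pairs this is the case `k = 1`.
  sizeCount-binom : ∀ {n} (α : Subset n) k →
    sizeCount α k ≈ fromℕ (binom (ℤ.+ n ℤ.- ℤ.+ ∣ α ∣) (ℤ.+ k ℤ.- ℤ.+ ∣ α ∣))
  sizeCount-binom {n} α k
    rewrite ℤ.m-n≡m⊖n n ∣ α ∣ | ℤ.⊖-≥ (Sub.∣p∣≤n α) | ≡.sym (Sub.∣∁p∣≡n∸∣p∣ α) | ℤ.m-n≡m⊖n k ∣ α ∣
    with ∣ α ∣ ℕ.≤? k
  ... | yes α≤k rewrite ℤ.⊖-≥ α≤k = trans
    (reflexive (≡.cong (sizeCount α) (≡.sym (ℕ.m+[n∸m]≡n α≤k)))) (sizeCount-+ α (k ℕ.∸ ∣ α ∣))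
  ... | no α≰k rewrite ℤ.⊖-< (ℕ.≰⇒> α≰k) with ∣ α ∣ ℕ.∸ k in eq
  ...   | zero  = contradiction (ℕ.m∸n≡0⇒m≤n eq) α≰k
  ...   | suc _ = sizeCount-< α (ℕ.≰⇒> α≰k)

  module _ {n} (A : Matrix Carrier n n) (k : ℕ) where

    minorOfSize : Subset n → Carrier
    minorOfSize β = if does (∣ β ∣ ℕ.≟ k) then det (principal A β) else 0#

    over avoiding : Subset n → Subset n → Carrier
    over     α β = if contains α β then minorOfSize β else 0#
    avoiding α β = if contains α (∁ β) then minorOfSize β else 0#

    minorsOver minorsAvoiding : Subset n → Carrier
    minorsOver     α = ∑ (supersets α) minorOfSize
    minorsAvoiding α = ∑ (subsets n) (avoiding α)

    -- A principal submatrix of `principal A (∁ α)` is a principal submatrix of `A`, on the index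
    -- set given by `within`.
    minorSum-∁ : ∀ α → minorSum (principal A (∁ α)) k ≈ minorsAvoiding α
    minorSum-∁ α = trans (∑-cong (subsets ∣ ∁ α ∣) same) (∑-within-∁ α minorOfSize)
      where
      same : ∀ β →
        (if does (∣ β ∣ ℕ.≟ k) then det (principal (principal A (∁ α)) β) else 0#) ≈ minorOfSize (within (∁ α) β)
      same β rewrite ≡.cong (λ t → does (t ℕ.≟ k)) (∣within∣ (∁ α) β) with does (∣ β ∣ ℕ.≟ k)
      ... | false = refl
      ... | true  = sym (det-cast (∣within∣ (∁ α) β)
        (principal A (within (∁ α) β)) (principal (principal A (∁ α)) β)
        λ i j → reflexive (≡.cong₂ A (enumerate-within (∁ α) β i) (enumerate-within (∁ α) β j)))

    -- `charCoeff` over an arbitrary commutative ring. Over ℂ the two agree by definition, so the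
    -- hypotheses on `charCoeff` apply as they stand.
    coefficient : Subset n → Carrier
    coefficient α = coeffℤ (ℤ.+ n ℤ.- ℤ.+ k ℤ.- ℤ.+ ∣ α ∣) (charPoly (principal A (∁ α)))

    -- The submatrix has order `∣ ∁ α ∣`, so the exponent in `coefficient` is `∣ ∁ α ∣ - k`, the one
    -- that selects `k`-minors. As `sign k` is its own inverse, it can change sides.
    minorsAvoiding-coeff : ∀ α → minorsAvoiding α ≈ sign k * coefficient α
    minorsAvoiding-coeff α = begin
      minorsAvoiding α
        ≈⟨ minorSum-∁ α ⟨
      minorSum (principal A (∁ α)) k
        ≈⟨ trans (*-congʳ (sign²≈1 k)) (*-identityˡ _) ⟨
      sign k * sign k * minorSum (principal A (∁ α)) k
        ≈⟨ *-assoc (sign k) (sign k) _ ⟩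
      sign k * (sign k * minorSum (principal A (∁ α)) k)
        ≈⟨ *-congˡ (coeff-charPoly (principal A (∁ α)) k) ⟨
      sign k * coeffℤ (ℤ.+ ∣ ∁ α ∣ ℤ.- ℤ.+ k) (charPoly (principal A (∁ α)))
        ≡⟨ ≡.cong (λ z → sign k * coeffℤ z (charPoly (principal A (∁ α)))) exponent ⟩
      sign k * coefficient α ∎
      where
      open ℤ-Solver using () renaming (solve to solveℤ; _:-_ to _⊝_; _:=_ to _≜_)
      exponent : ℤ.+ ∣ ∁ α ∣ ℤ.- ℤ.+ k ≡ ℤ.+ n ℤ.- ℤ.+ k ℤ.- ℤ.+ ∣ α ∣
      exponent = ≡.trans
        (≡.cong (ℤ._- ℤ.+ k) (≡.trans (≡.cong ℤ.+_ (Sub.∣∁p∣≡n∸∣p∣ α))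
          (≡.trans (≡.sym (ℤ.⊖-≥ (Sub.∣p∣≤n α))) (≡.sym (ℤ.m-n≡m⊖n n ∣ α ∣)))))
        (solveℤ 3 (λ n a k → n ⊝ a ⊝ k ≜ n ⊝ k ⊝ a) ≡.refl (ℤ.+ n) (ℤ.+ ∣ α ∣) (ℤ.+ k))

    minorsAvoiding-⊥ : minorsAvoiding ⊥ ≈ ∑ (subsets n) minorOfSize
    minorsAvoiding-⊥ = ∑-cong (subsets n) λ β →
      reflexive (≡.cong (if_then minorOfSize β else 0#) (contains-⊥ (∁ β)))

    minorsOver-⁅⁆ : ∀ x → minorsOver ⁅ x ⁆ + minorsAvoiding ⁅ x ⁆ ≈ minorsAvoiding ⊥
    minorsOver-⁅⁆ x = begin
      minorsOver ⁅ x ⁆ + minorsAvoiding ⁅ x ⁆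
        ≈⟨ +-congʳ (∑-contains ⁅ x ⁆ minorOfSize) ⟩
      _
        ≈⟨ ∑-distrib-+ (subsets n) (over ⁅ x ⁆) (avoiding ⁅ x ⁆) ⟨
      ∑ (subsets n) (λ β → over ⁅ x ⁆ β + avoiding ⁅ x ⁆ β)
        ≈⟨ ∑-cong (subsets n) pointwise ⟩
      ∑ (subsets n) minorOfSize
        ≈⟨ minorsAvoiding-⊥ ⟨
      minorsAvoiding ⊥ ∎
      where
      pointwise : ∀ β → over ⁅ x ⁆ β + avoiding ⁅ x ⁆ β ≈ minorOfSize β
      pointwise β rewrite contains-⁅⁆ x β | contains-⁅⁆ x (∁ β) | Vec.lookup-map x not β with lookup β x
      ... | true  = +-identityʳ _
      ... | false = +-identityˡ _

    -- Inclusion-exclusion with the subtracted terms moved across, so that each `β` is settled by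
    -- the four cases of membership of `x` and `y`, without cancellation.
    minorsOver-⁅⁆∪⁅⁆ : ∀ x y → minorsOver (⁅ x ⁆ ∪ ⁅ y ⁆) + (minorsAvoiding ⁅ x ⁆ + minorsAvoiding ⁅ y ⁆) ≈
      minorsAvoiding ⊥ + minorsAvoiding (⁅ x ⁆ ∪ ⁅ y ⁆)
    minorsOver-⁅⁆∪⁅⁆ x y = begin
      minorsOver (⁅ x ⁆ ∪ ⁅ y ⁆) + (minorsAvoiding ⁅ x ⁆ + minorsAvoiding ⁅ y ⁆)
        ≈⟨ +-cong (∑-contains (⁅ x ⁆ ∪ ⁅ y ⁆) minorOfSize)
                  (sym (∑-distrib-+ (subsets n) (avoiding ⁅ x ⁆) (avoiding ⁅ y ⁆))) ⟩
      _
        ≈⟨ ∑-distrib-+ (subsets n) (over (⁅ x ⁆ ∪ ⁅ y ⁆))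
             (λ β → avoiding ⁅ x ⁆ β + avoiding ⁅ y ⁆ β) ⟨
      _
        ≈⟨ ∑-cong (subsets n) pointwise ⟩
      ∑ (subsets n) (λ β → minorOfSize β + avoiding (⁅ x ⁆ ∪ ⁅ y ⁆) β)
        ≈⟨ ∑-distrib-+ (subsets n) minorOfSize (avoiding (⁅ x ⁆ ∪ ⁅ y ⁆)) ⟩
      _
        ≈⟨ +-congʳ minorsAvoiding-⊥ ⟨
      minorsAvoiding ⊥ + minorsAvoiding (⁅ x ⁆ ∪ ⁅ y ⁆) ∎
      where
      pointwise : ∀ β → over (⁅ x ⁆ ∪ ⁅ y ⁆) β + (avoiding ⁅ x ⁆ β + avoiding ⁅ y ⁆ β)
        ≈ minorOfSize β + avoiding (⁅ x ⁆ ∪ ⁅ y ⁆) β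
      pointwise β
        rewrite contains-∪ ⁅ x ⁆ ⁅ y ⁆ β | contains-∪ ⁅ x ⁆ ⁅ y ⁆ (∁ β)
              | contains-⁅⁆ x β | contains-⁅⁆ x (∁ β) | contains-⁅⁆ y β | contains-⁅⁆ y (∁ β)
              | Vec.lookup-map x not β | Vec.lookup-map y not β
        with lookup β x | lookup β y
      ... | true  | true  = +-congˡ (+-identityˡ 0#)
      ... | true  | false = trans (+-identityˡ _) (+-comm _ _)
      ... | false | true  = +-identityˡ _
      ... | false | false = +-identityˡ _

    minorsAvoiding-≈ : ∀ α {z} → coefficient α ≈ z → minorsAvoiding α ≈ sign k * z
    minorsAvoiding-≈ α eq = trans (minorsAvoiding-coeff α) (*-congˡ eq)

    minorsOver-⁅⁆-coeff : ∀ x {c₀ c₁} → coefficient ⊥ ≈ c₀ → coefficient ⁅ x ⁆ ≈ c₁ →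
      minorsOver ⁅ x ⁆ ≈ sign k * (c₀ - c₁)
    minorsOver-⁅⁆-coeff x {c₀} {c₁} eq₀ eq₁ = sym (begin
      s * (c₀ - c₁)
        ≈⟨ distribˡ s c₀ (- c₁) ⟩
      s * c₀ + s * - c₁
        ≈⟨ +-congʳ (trans (sym (minorsAvoiding-≈ ⊥ eq₀))
             (trans (sym (minorsOver-⁅⁆ x)) (+-congˡ (minorsAvoiding-≈ ⁅ x ⁆ eq₁)))) ⟩
      t + s * c₁ + s * - c₁
        ≈⟨ solve 4 (λ t s c c′ → t :+ s :* c :+ s :* c′ := t :+ s :* (c :+ c′)) refl t s c₁ (- c₁) ⟩
      t + s * (c₁ - c₁)
        ≈⟨ +-congˡ (trans (*-congˡ (-‿inverseʳ c₁)) (zeroʳ s)) ⟩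
      t + 0#
        ≈⟨ +-identityʳ t ⟩
      t ∎)
      where
      s = sign k
      t = minorsOver ⁅ x ⁆

    minorsOver-⁅⁆∪⁅⁆-coeff : ∀ x y {c₀ c₁ c₂} → coefficient ⊥ ≈ c₀ →
      coefficient ⁅ x ⁆ ≈ c₁ → coefficient ⁅ y ⁆ ≈ c₁ →
      coefficient (⁅ x ⁆ ∪ ⁅ y ⁆) ≈ c₂ →
      minorsOver (⁅ x ⁆ ∪ ⁅ y ⁆) ≈ sign k * (c₀ - fromℕ 2 * c₁ + c₂)
    minorsOver-⁅⁆∪⁅⁆-coeff x y {c₀} {c₁} {c₂} eq₀ eqˣ eqʸ eq₂ = sym (begin
      s * (c₀ - fromℕ 2 * c₁ + c₂)
        ≈⟨ solve 4 (λ s c₀ m c₂ → s :* (c₀ :+ m :+ c₂) := s :* c₀ :+ s :* c₂ :+ s :* m) refl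
             s c₀ (- (fromℕ 2 * c₁)) c₂ ⟩
      s * c₀ + s * c₂ + s * - (fromℕ 2 * c₁)
        ≈⟨ +-congʳ (trans
             (sym (+-cong (minorsAvoiding-≈ ⊥ eq₀) (minorsAvoiding-≈ (⁅ x ⁆ ∪ ⁅ y ⁆) eq₂)))
             (trans (sym (minorsOver-⁅⁆∪⁅⁆ x y))
               (+-congˡ (+-cong (minorsAvoiding-≈ ⁅ x ⁆ eqˣ) (minorsAvoiding-≈ ⁅ y ⁆ eqʸ))))) ⟩
      t + (s * c₁ + s * c₁) + s * - (fromℕ 2 * c₁)
        -- The coefficient is spelled as the unfolding of `fromℕ 2`.
        ≈⟨ solve 4 (λ t s c m → t :+ (s :* c :+ s :* c) :+ s :* m :=
             t :+ s :* ((con 1 :+ (con 1 :+ con 0)) :* c :+ m)) refl t s c₁ (- (fromℕ 2 * c₁)) ⟩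
      t + s * (fromℕ 2 * c₁ - fromℕ 2 * c₁)
        ≈⟨ +-congˡ (trans (*-congˡ (-‿inverseʳ (fromℕ 2 * c₁))) (zeroʳ s)) ⟩
      t + 0#
        ≈⟨ +-identityʳ t ⟩
      t ∎)
      where
      s = sign k
      t = minorsOver (⁅ x ⁆ ∪ ⁅ y ⁆)

    -- Numbers of `k`-subsets with each of the three values

    module ThreeValues (a b c : Carrier) (a≉b : ¬ a ≈ b) (a≉c : ¬ a ≈ c) (b≉c : ¬ b ≈ c)
      (values : ∀ β → ∣ β ∣ ≡ k → det (principal A β) ≈ a ⊎ det (principal A β) ≈ b ⊎ det (principal A β) ≈ c)
      where

      HasMinor : Carrier → Pred (Subset n) ℓ
      HasMinor z β = ∣ β ∣ ≡ k × det (principal A β) ≈ z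

      -- The three deciders branch on the same tests, `∣ β ∣ ≟ k` and `values`, so that in
      -- `partition` and `weighted` one case split evaluates all three indicators together.
      hasA? : Decidable (HasMinor a)
      hasA? β with ∣ β ∣ ℕ.≟ k
      ... | no ≢k = no (≢k ∘ proj₁)
      ... | yes ≡k with values β ≡k
      ...   | inj₁ ≈a        = yes (≡k , ≈a)
      ...   | inj₂ (inj₁ ≈b) = no λ (_ , ≈a) → a≉b (trans (sym ≈a) ≈b)
      ...   | inj₂ (inj₂ ≈c) = no λ (_ , ≈a) → a≉c (trans (sym ≈a) ≈c)

      hasB? : Decidable (HasMinor b)
      hasB? β with ∣ β ∣ ℕ.≟ k
      ... | no ≢k = no (≢k ∘ proj₁)
      ... | yes ≡k with values β ≡k
      ...   | inj₁ ≈a        = no λ (_ , ≈b) → a≉b (trans (sym ≈a) ≈b)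
      ...   | inj₂ (inj₁ ≈b) = yes (≡k , ≈b)
      ...   | inj₂ (inj₂ ≈c) = no λ (_ , ≈b) → b≉c (trans (sym ≈b) ≈c)

      hasC? : Decidable (HasMinor c)
      hasC? β with ∣ β ∣ ℕ.≟ k
      ... | no ≢k = no (≢k ∘ proj₁)
      ... | yes ≡k with values β ≡k
      ...   | inj₁ ≈a        = no λ (_ , ≈c) → a≉c (trans (sym ≈a) ≈c)
      ...   | inj₂ (inj₁ ≈b) = no λ (_ , ≈c) → b≉c (trans (sym ≈b) ≈c)
      ...   | inj₂ (inj₂ ≈c) = yes (≡k , ≈c)

      #a #b #c : Subset n → ℕ
      #a α = length (filter hasA? (supersets α))
      #b α = length (filter hasB? (supersets α))
      #c α = length (filter hasC? (supersets α))

      private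
        [a] [b] [c] : Subset n → Carrier
        [a] β = if does (hasA? β) then 1# else 0#
        [b] β = if does (hasB? β) then 1# else 0#
        [c] β = if does (hasC? β) then 1# else 0#

      partition : ∀ α → fromℕ (#a α) + (fromℕ (#b α) + fromℕ (#c α)) ≈ sizeCount α k
      partition α = begin
        fromℕ (#a α) + (fromℕ (#b α) + fromℕ (#c α))
          ≈⟨ +-cong (fromℕ-length-filter hasA? (supersets α)) (+-cong
               (fromℕ-length-filter hasB? (supersets α)) (fromℕ-length-filter hasC? (supersets α))) ⟩
        ∑ (supersets α) [a] + (∑ (supersets α) [b] + ∑ (supersets α) [c])
          ≈⟨ trans (∑-distrib-+ (supersets α) [a] (λ β → [b] β + [c] β))
                   (+-congˡ (∑-distrib-+ (supersets α) [b] [c])) ⟨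
        ∑ (supersets α) (λ β → [a] β + ([b] β + [c] β))
          ≈⟨ ∑-cong (supersets α) pointwise ⟩
        sizeCount α k ∎
        where
        pointwise : ∀ β → [a] β + ([b] β + [c] β) ≈ (if does (∣ β ∣ ℕ.≟ k) then 1# else 0#)
        pointwise β with ∣ β ∣ ℕ.≟ k
        ... | no ≢k rewrite dec-false (∣ β ∣ ℕ.≟ k) ≢k = trans (+-identityˡ _) (+-identityˡ _)
        ... | yes ≡k rewrite dec-true (∣ β ∣ ℕ.≟ k) ≡k with values β ≡k
        ...   | inj₁ _        = trans (+-congˡ (+-identityˡ 0#)) (+-identityʳ 1#)
        ...   | inj₂ (inj₁ _) = trans (+-identityˡ _) (+-identityʳ 1#)
        ...   | inj₂ (inj₂ _) = trans (+-identityˡ _) (+-identityˡ 1#)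

      weighted : ∀ α → a * fromℕ (#a α) + (b * fromℕ (#b α) + c * fromℕ (#c α)) ≈ minorsOver α
      weighted α = begin
        a * fromℕ (#a α) + (b * fromℕ (#b α) + c * fromℕ (#c α))
          ≈⟨ +-cong (scaled a hasA?) (+-cong (scaled b hasB?) (scaled c hasC?)) ⟩
        _
          ≈⟨ trans (∑-distrib-+ (supersets α) (λ β → a * [a] β) (λ β → b * [b] β + c * [c] β))
                   (+-congˡ (∑-distrib-+ (supersets α) (λ β → b * [b] β) (λ β → c * [c] β))) ⟨
        ∑ (supersets α) (λ β → a * [a] β + (b * [b] β + c * [c] β))
          ≈⟨ ∑-cong (supersets α) pointwise ⟩
        minorsOver α ∎
        where
        scaled : ∀ z {P : Pred (Subset n) ℓ} (P? : Decidable P) →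
          z * fromℕ (length (filter P? (supersets α))) ≈
          ∑ (supersets α) (λ β → z * (if does (P? β) then 1# else 0#))
        scaled z P? = trans (*-congˡ (fromℕ-length-filter P? (supersets α))) (*-distribˡ-∑ (supersets α) _ z)
        pointwise : ∀ β → a * [a] β + (b * [b] β + c * [c] β) ≈ minorOfSize β
        pointwise β with ∣ β ∣ ℕ.≟ k
        ... | no ≢k rewrite dec-false (∣ β ∣ ℕ.≟ k) ≢k =
          solve 3 (λ a b c → a :* con 0 :+ (b :* con 0 :+ c :* con 0) := con 0) refl a b c
        ... | yes ≡k rewrite dec-true (∣ β ∣ ℕ.≟ k) ≡k with values β ≡k
        ...   | inj₁ ≈a        = trans
          (solve 3 (λ a b c → a :* con 1 :+ (b :* con 0 :+ c :* con 0) := a) refl a b c) (sym ≈a)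
        ...   | inj₂ (inj₁ ≈b) = trans
          (solve 3 (λ a b c → a :* con 0 :+ (b :* con 1 :+ c :* con 0) := b) refl a b c) (sym ≈b)
        ...   | inj₂ (inj₂ ≈c) = trans
          (solve 3 (λ a b c → a :* con 0 :+ (b :* con 0 :+ c :* con 1) := c) refl a b c) (sym ≈c)

      -- In `weighted` minus `b` times `partition` the terms with `#b` cancel. The inverse of
      -- `a - b` enters as an element `u` with its defining equation, which makes the elimination a
      -- computation in a ring without division.
      count : ∀ α u → (a - b) * u ≈ 1# →
        fromℕ (#a α) ≈ u * minorsOver α - b * u * sizeCount α k - (c - b) * u * fromℕ (#c α)
      count α u inv = sym (begin
        u * minorsOver α - b * u * sizeCount α k - (c - b) * u * r
          ≈⟨ +-cong (+-cong (*-congˡ (sym (weighted α)))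
                      (trans (-‿cong (*-congˡ (sym (partition α)))) negate-b)) negate-c-b ⟩
        u * (a * p + (b * q + c * r)) + - b * u * (p + (q + r)) + (- c + b) * u * r
          -- The solver works over a semiring, so `- b` and `- c` enter as independent variables;
          -- the next step cancels them against `b` and `c`.
          ≈⟨ solve 9 (λ u a b c b′ c′ p q r →
                 u :* (a :* p :+ (b :* q :+ c :* r)) :+ b′ :* u :* (p :+ (q :+ r)) :+ (c′ :+ b) :* u :* r :=
                 (a :+ b′) :* u :* p :+ (b :+ b′) :* (u :* (q :+ r)) :+ (c :+ c′) :* (u :* r)) refl
               u a b c (- b) (- c) p q r ⟩
        (a - b) * u * p + (b - b) * (u * (q + r)) + (c - c) * (u * r)
          ≈⟨ +-cong (+-cong (trans (*-congʳ inv) (*-identityˡ p)) (trans (*-congʳ (-‿inverseʳ b)) (zeroˡ _)))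
                    (trans (*-congʳ (-‿inverseʳ c)) (zeroˡ _)) ⟩
        p + 0# + 0#
          ≈⟨ trans (+-identityʳ _) (+-identityʳ p) ⟩
        p ∎)
        where
        p = fromℕ (#a α)
        q = fromℕ (#b α)
        r = fromℕ (#c α)
        negate-b : - (b * u * (p + (q + r))) ≈ - b * u * (p + (q + r))
        negate-b = trans (-‿distribˡ-* (b * u) _) (*-congʳ (-‿distribˡ-* b u))
        negate-c-b : - ((c - b) * u * r) ≈ (- c + b) * u * r
        negate-c-b = trans (-‿distribˡ-* ((c - b) * u) r) (*-congʳ (trans (-‿distribˡ-* (c - b) u)
          (*-congʳ (trans (sym (-‿+-comm c (- b))) (+-congˡ (-‿involutive b))))))

      count-formula : ∀ α u t r → (a - b) * u ≈ 1# → minorsOver α ≈ sign k * t → #c α ≡ r →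
        fromℕ (#a α) ≈ sign k * u * t
          - b * u * fromℕ (binom (ℤ.+ n ℤ.- ℤ.+ ∣ α ∣) (ℤ.+ k ℤ.- ℤ.+ ∣ α ∣)) - (c - b) * u * fromℕ r
      count-formula α u t r inv over≈ ≡.refl = trans (count α u inv) (+-congʳ (+-cong
        (trans (*-congˡ over≈) (solve 3 (λ s u t → u :* (s :* t) := s :* u :* t) refl (sign k) u t))
        (-‿cong (*-congˡ (sizeCount-binom α k)))))

      count-⁅⁆ : ∀ x {c₀ c₁ u r} → (a - b) * u ≈ 1# →
        coefficient ⊥ ≈ c₀ → coefficient ⁅ x ⁆ ≈ c₁ → #c ⁅ x ⁆ ≡ r →
        fromℕ (#a ⁅ x ⁆) ≈ sign k * u * (c₀ - c₁)
          - b * u * fromℕ (binom (ℤ.+ n ℤ.- ℤ.+ 1) (ℤ.+ k ℤ.- ℤ.+ 1)) - (c - b) * u * fromℕ r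
      count-⁅⁆ x {c₀} {c₁} {u} {r} inv eq₀ eq₁ #c≡r = ≡.subst
        (λ t → fromℕ (#a ⁅ x ⁆) ≈ sign k * u * (c₀ - c₁)
          - b * u * fromℕ (binom (ℤ.+ n ℤ.- ℤ.+ t) (ℤ.+ k ℤ.- ℤ.+ t)) - (c - b) * u * fromℕ r)
        (Sub.∣⁅x⁆∣≡1 x)
        (count-formula ⁅ x ⁆ u (c₀ - c₁) r inv (minorsOver-⁅⁆-coeff x eq₀ eq₁) #c≡r)

      count-⁅⁆∪⁅⁆ : ∀ x y {c₀ c₁ c₂ u r} → x ≢ y → (a - b) * u ≈ 1# → coefficient ⊥ ≈ c₀ →
        coefficient ⁅ x ⁆ ≈ c₁ → coefficient ⁅ y ⁆ ≈ c₁ → coefficient (⁅ x ⁆ ∪ ⁅ y ⁆) ≈ c₂ →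
        #c (⁅ x ⁆ ∪ ⁅ y ⁆) ≡ r →
        fromℕ (#a (⁅ x ⁆ ∪ ⁅ y ⁆)) ≈ sign k * u * (c₀ - fromℕ 2 * c₁ + c₂)
          - b * u * fromℕ (binom (ℤ.+ n ℤ.- ℤ.+ 2) (ℤ.+ k ℤ.- ℤ.+ 2)) - (c - b) * u * fromℕ r
      count-⁅⁆∪⁅⁆ x y {c₀} {c₁} {c₂} {u} {r} x≢y inv eq₀ eqˣ eqʸ eq₂ #c≡r = ≡.subst
        (λ t → fromℕ (#a (⁅ x ⁆ ∪ ⁅ y ⁆)) ≈ sign k * u * (c₀ - fromℕ 2 * c₁ + c₂)
          - b * u * fromℕ (binom (ℤ.+ n ℤ.- ℤ.+ t) (ℤ.+ k ℤ.- ℤ.+ t)) - (c - b) * u * fromℕ r)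
        (∣⁅x⁆∪⁅y⁆∣≡2 x≢y)
        (count-formula (⁅ x ⁆ ∪ ⁅ y ⁆) u (c₀ - fromℕ 2 * c₁ + c₂) r inv
          (minorsOver-⁅⁆∪⁅⁆-coeff x y eq₀ eqˣ eqʸ eq₂) #c≡r)

-- Real and complex numbers

module RealProperties where

  open Real
  open ℚ-Solver

  -- The ring laws hold term by term for the representing rational sequences, so estimates are
  -- needed only for the congruences.
  pointwise : ∀ x y → (∀ n → seq x n ≡ seq y n) → x ≃ y
  pointwise x y eq ε 0<ε = 0 , λ n _ → ≡.subst (ℚ._< ε)
    (≡.sym (≡.cong ℚ.∣_∣ (≡.trans (≡.cong (ℚ._- seq y n) (eq n)) (ℚ.+-inverseʳ (seq y n))))) 0<ε

  ≃-sym : ∀ x y → x ≃ y → y ≃ x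
  ≃-sym x y x≃y ε 0<ε with x≃y ε 0<ε
  ... | N , f = N , λ n p → ≡.subst (ℚ._< ε)
    (≡.trans (≡.sym (ℚ.∣-p∣≡∣p∣ (seq x n ℚ.- seq y n)))
             (≡.cong ℚ.∣_∣ (solve 2 (λ a b → :- (a :- b) := b :- a) ≡.refl (seq x n) (seq y n))))
    (f n p)

  ∣+∣-< : ∀ {ε} a b → ℚ.∣ a ∣ ℚ.< ½ ℚ.* ε → ℚ.∣ b ∣ ℚ.< ½ ℚ.* ε → ℚ.∣ a ℚ.+ b ∣ ℚ.< ε
  ∣+∣-< {ε} a b a< b< = ℚ.≤-<-trans (ℚ.∣p+q∣≤∣p∣+∣q∣ a b) (≡.subst (_ ℚ.<_) (halves ε) (ℚ.+-mono-< a< b<))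

  ≃-trans : ∀ x y z → x ≃ y → y ≃ z → x ≃ z
  ≃-trans x y z x≃y y≃z ε 0<ε with x≃y (½ ℚ.* ε) (½* 0<ε) | y≃z (½ ℚ.* ε) (½* 0<ε)
  ... | M , f | N , g = M ℕ.⊔ N , λ n p → ≡.subst (λ d → ℚ.∣ d ∣ ℚ.< ε)
    (solve 3 (λ a b c → (a :- b) :+ (b :- c) := a :- c) ≡.refl (seq x n) (seq y n) (seq z n))
    (∣+∣-< {ε} (seq x n ℚ.- seq y n) (seq y n ℚ.- seq z n) (f n (ℕ.m⊔n≤o⇒m≤o M N p)) (g n (ℕ.m⊔n≤o⇒n≤o M N p)))

  +-cong : ∀ x x′ y y′ → x ≃ x′ → y ≃ y′ → x + y ≃ x′ + y′
  +-cong x x′ y y′ x≃ y≃ ε 0<ε with x≃ (½ ℚ.* ε) (½* 0<ε) | y≃ (½ ℚ.* ε) (½* 0<ε)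
  ... | M , f | N , g = M ℕ.⊔ N , λ n p → ≡.subst (λ d → ℚ.∣ d ∣ ℚ.< ε)
    (solve 4 (λ a b c d → (a :- c) :+ (b :- d) := (a :+ b) :- (c :+ d)) ≡.refl (seq x n) (seq y n) (seq x′ n) (seq y′ n))
    (∣+∣-< {ε} (seq x n ℚ.- seq x′ n) (seq y n ℚ.- seq y′ n) (f n (ℕ.m⊔n≤o⇒m≤o M N p)) (g n (ℕ.m⊔n≤o⇒n≤o M N p)))

  neg-cong : ∀ x x′ → x ≃ x′ → - x ≃ - x′
  neg-cong x x′ x≃ ε 0<ε with x≃ ε 0<ε
  ... | N , f = N , λ n p → ≡.subst (ℚ._< ε)
    (≡.trans (≡.sym (ℚ.∣-p∣≡∣p∣ (seq x n ℚ.- seq x′ n)))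
             (≡.cong ℚ.∣_∣ (solve 2 (λ a b → :- (a :- b) := :- a :- (:- b)) ≡.refl (seq x n) (seq x′ n))))
    (f n p)

  *-cong : ∀ x x′ y y′ → x ≃ x′ → y ≃ y′ → x * y ≃ x′ * y′
  *-cong x x′ y y′ x≃ y≃ ε 0<ε =
    -- `*-split` multiplies the two differences by `x` and by `y′`, so these are the factors to be
    -- bounded.
    let B , 0<B , K , bx = bounded x
        B′ , 0<B′ , L , by = bounded y′
        M , f = x≃ (½ ℚ.* ε ℚ.* recip B′) (*-pos (½* 0<ε) (recip-pos 0<B′))
        N , g = y≃ (½ ℚ.* ε ℚ.* recip B) (*-pos (½* 0<ε) (recip-pos 0<B))
    in (K ℕ.⊔ L) ℕ.⊔ (M ℕ.⊔ N) , λ n p →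
    let a = seq x n ; b = seq y n ; c = seq x′ n ; d = seq y′ n
        p₁ = ℕ.m⊔n≤o⇒m≤o (K ℕ.⊔ L) (M ℕ.⊔ N) p ; p₂ = ℕ.m⊔n≤o⇒n≤o (K ℕ.⊔ L) (M ℕ.⊔ N) p
    in ℚ.≤-<-trans (*-split a b c d) (≡.subst (_ ℚ.<_) (halves ε) (ℚ.+-mono-<
         (scale {e = ½ ℚ.* ε} 0<B (ℚ.0≤∣p∣ (b ℚ.- d)) (bx n (ℕ.m⊔n≤o⇒m≤o K L p₁)) (g n (ℕ.m⊔n≤o⇒n≤o M N p₂)))
         (scale {e = ½ ℚ.* ε} 0<B′ (ℚ.0≤∣p∣ (a ℚ.- c)) (by n (ℕ.m⊔n≤o⇒n≤o K L p₁)) (f n (ℕ.m⊔n≤o⇒m≤o M N p₂)))))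

  -- From `N` on the terms of `x` are positive rationals and the products are exactly `1ℚ`; the
  -- terms where `recip` may take its default value lie before `N`.
  *-inverseʳ : ∀ x (0<x : Positive x) → x * x ⁻¹⟨ 0<x ⟩ ≃ fromℚ 1ℚ
  *-inverseʳ x (δ , 0<δ , N , low) ε 0<ε = N , λ n p → ≡.subst (ℚ._< ε)
    (≡.sym (≡.cong ℚ.∣_∣ (≡.cong (ℚ._- 1ℚ) (recip-inverse (ℚ.<-≤-trans 0<δ (low n p)))))) 0<ε

  positive⇒≄0 : ∀ x → Positive x → ¬ x ≃ fromℚ 0ℚ
  positive⇒≄0 x (δ , 0<δ , M , low) x≃0 with x≃0 δ 0<δ
  ... | N , f = ℚ.<-irrefl ≡.refl (begin-strict
    δ                       ≤⟨ low n (ℕ.m≤m⊔n M N) ⟩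
    seq x n                 ≡⟨ ℚ.0≤p⇒∣p∣≡p (ℚ.<⇒≤ (ℚ.<-≤-trans 0<δ (low n (ℕ.m≤m⊔n M N)))) ⟨
    ℚ.∣ seq x n ∣           ≡⟨ ≡.cong ℚ.∣_∣ (ℚ.+-identityʳ (seq x n)) ⟨
    ℚ.∣ seq x n ℚ.- 0ℚ ∣    <⟨ f n (ℕ.m≤n⊔m M N) ⟩
    δ                       ∎)
    where
    open ℚ.≤-Reasoning
    n = M ℕ.⊔ N

open import Defs

ℂ-commutativeRing : CommutativeRing 0ℓ 0ℓ
ℂ-commutativeRing = record
  { Carrier = ℂ
  ; _≈_     = _≈_
  ; _+_     = _+_
  ; _*_     = _*_
  ; -_      = -_
  ; 0#      = 0#
  ; 1#      = 1#
  ; isCommutativeRing = record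
    { isRing = record
      { +-isAbelianGroup = record
        { isGroup = record
          { isMonoid = record
            { isSemigroup = record
              { isMagma = record
                { isEquivalence = record
                  { refl  = λ {z} → same z z (λ _ → ≡.refl) (λ _ → ≡.refl)
                  ; sym   = λ {z} {w} (p , q) → ≃-sym (re z) (re w) p , ≃-sym (im z) (im w) q
                  ; trans = λ {z} {w} {u} (p , q) (p′ , q′) →
                      ≃-trans (re z) (re w) (re u) p p′ , ≃-trans (im z) (im w) (im u) q q′
                  }
                ; ∙-cong = λ {z} {z′} {w} {w′} (p , q) (p′ , q′) →
                    R.+-cong (re z) (re z′) (re w) (re w′) p p′ , R.+-cong (im z) (im z′) (im w) (im w′) q q′
                }
              ; assoc = λ z w u → same (z + w + u) (z + (w + u))
                  (λ n → ℚ.+-assoc (seq (re z) n) (seq (re w) n) (seq (re u) n))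
                  (λ n → ℚ.+-assoc (seq (im z) n) (seq (im w) n) (seq (im u) n))
              }
            ; identity = (λ z → same (0# + z) z (λ n → ℚ.+-identityˡ (seq (re z) n)) (λ n → ℚ.+-identityˡ (seq (im z) n)))
                       , (λ z → same (z + 0#) z (λ n → ℚ.+-identityʳ (seq (re z) n)) (λ n → ℚ.+-identityʳ (seq (im z) n)))
            }
          ; inverse = (λ z → same (- z + z) 0# (λ n → ℚ.+-inverseˡ (seq (re z) n)) (λ n → ℚ.+-inverseˡ (seq (im z) n)))
                    , (λ z → same (z + - z) 0# (λ n → ℚ.+-inverseʳ (seq (re z) n)) (λ n → ℚ.+-inverseʳ (seq (im z) n)))
          ; ⁻¹-cong = λ {z} {w} (p , q) → R.neg-cong (re z) (re w) p , R.neg-cong (im z) (im w) q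
          }
        ; comm = λ z w → same (z + w) (w + z)
            (λ n → ℚ.+-comm (seq (re z) n) (seq (re w) n)) (λ n → ℚ.+-comm (seq (im z) n) (seq (im w) n))
        }
      ; *-cong = λ {z} {z′} {w} {w′} → *-cong z z′ w w′
      ; *-assoc = λ z w u → same (z * w * u) (z * (w * u))
          (λ n → solve 6 (λ a b c d e f →
              (a :* c :+ :- (b :* d)) :* e :+ :- ((a :* d :+ b :* c) :* f) :=
              a :* (c :* e :+ :- (d :* f)) :+ :- (b :* (c :* f :+ d :* e))) ≡.refl
            (seq (re z) n) (seq (im z) n) (seq (re w) n) (seq (im w) n) (seq (re u) n) (seq (im u) n))
          (λ n → solve 6 (λ a b c d e f →
              (a :* c :+ :- (b :* d)) :* f :+ (a :* d :+ b :* c) :* e :=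
              a :* (c :* f :+ d :* e) :+ b :* (c :* e :+ :- (d :* f))) ≡.refl
            (seq (re z) n) (seq (im z) n) (seq (re w) n) (seq (im w) n) (seq (re u) n) (seq (im u) n))
      ; *-identity = (λ z → same (1# * z) z
                       (λ n → solve 2 (λ a b → con 1ℚ :* a :+ :- (con 0ℚ :* b) := a) ≡.refl (seq (re z) n) (seq (im z) n))
                       (λ n → solve 2 (λ a b → con 1ℚ :* b :+ con 0ℚ :* a := b) ≡.refl (seq (re z) n) (seq (im z) n)))
                   , (λ z → same (z * 1#) z
                       (λ n → solve 2 (λ a b → a :* con 1ℚ :+ :- (b :* con 0ℚ) := a) ≡.refl (seq (re z) n) (seq (im z) n))
                       (λ n → solve 2 (λ a b → a :* con 0ℚ :+ b :* con 1ℚ := b) ≡.refl (seq (re z) n) (seq (im z) n)))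
      ; distrib = (λ z w u → same (z * (w + u)) (z * w + z * u)
                    (λ n → solve 6 (λ a b c d e f →
                        a :* (c :+ e) :+ :- (b :* (d :+ f)) := (a :* c :+ :- (b :* d)) :+ (a :* e :+ :- (b :* f))) ≡.refl
                      (seq (re z) n) (seq (im z) n) (seq (re w) n) (seq (im w) n) (seq (re u) n) (seq (im u) n))
                    (λ n → solve 6 (λ a b c d e f →
                        a :* (d :+ f) :+ b :* (c :+ e) := (a :* d :+ b :* c) :+ (a :* f :+ b :* e)) ≡.refl
                      (seq (re z) n) (seq (im z) n) (seq (re w) n) (seq (im w) n) (seq (re u) n) (seq (im u) n)))
                , (λ z w u → same ((w + u) * z) (w * z + u * z)
                    (λ n → solve 6 (λ a b c d e f →
                        (c :+ e) :* a :+ :- ((d :+ f) :* b) := (c :* a :+ :- (d :* b)) :+ (e :* a :+ :- (f :* b))) ≡.refl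
                      (seq (re z) n) (seq (im z) n) (seq (re w) n) (seq (im w) n) (seq (re u) n) (seq (im u) n))
                    (λ n → solve 6 (λ a b c d e f →
                        (c :+ e) :* b :+ (d :+ f) :* a := (c :* b :+ d :* a) :+ (e :* b :+ f :* a)) ≡.refl
                      (seq (re z) n) (seq (im z) n) (seq (re w) n) (seq (im w) n) (seq (re u) n) (seq (im u) n)))
      }
    ; *-comm = λ z w → same (z * w) (w * z)
        (λ n → solve 4 (λ a b c d → a :* c :+ :- (b :* d) := c :* a :+ :- (d :* b)) ≡.refl
          (seq (re z) n) (seq (im z) n) (seq (re w) n) (seq (im w) n))
        (λ n → solve 4 (λ a b c d → a :* d :+ b :* c := c :* b :+ d :* a) ≡.refl
          (seq (re z) n) (seq (im z) n) (seq (re w) n) (seq (im w) n))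
    }
  }
  where
  open Real using (seq; _≃_)
  module R = RealProperties
  open RealProperties using (≃-sym; ≃-trans)
  open ℚ-Solver
  same : ∀ z w → (∀ n → seq (re z) n ≡ seq (re w) n) → (∀ n → seq (im z) n ≡ seq (im w) n) → z ≈ w
  same z w p q = RealProperties.pointwise (re z) (re w) p , RealProperties.pointwise (im z) (im w) q
  *-cong : ∀ z z′ w w′ → z ≈ z′ → w ≈ w′ → z * w ≈ z′ * w′
  *-cong z z′ w w′ (p , q) (p′ , q′) =
      R.+-cong (re z Real.* re w) (re z′ Real.* re w′) (Real.- (im z Real.* im w)) (Real.- (im z′ Real.* im w′))
        (R.*-cong (re z) (re z′) (re w) (re w′) p p′)
        (R.neg-cong (im z Real.* im w) (im z′ Real.* im w′) (R.*-cong (im z) (im z′) (im w) (im w′) q q′))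
    , R.+-cong (re z Real.* im w) (re z′ Real.* im w′) (im z Real.* re w) (im z′ Real.* re w′)
        (R.*-cong (re z) (re z′) (im w) (im w′) p q′)
        (R.*-cong (im z) (im z′) (re w) (re w′) q p′)

private module 𝕂 = CommutativeRing ℂ-commutativeRing

-- Inverses, apartness and characteristic zero

module ComplexProperties where

  open Real using (seq; _≃_; fromℚ)
  open RealProperties
  open ℚ-Solver

  *-inverse : ∀ z (z#0 : z #0) → z * z ⁻¹⟨ z#0 ⟩ ≈ 1#
  *-inverse z z#0 =
      ≃-trans (re (z * z ⁻¹⟨ z#0 ⟩)) (∣ z ∣² Real.* r) (fromℚ 1ℚ)
        (pointwise (re (z * z ⁻¹⟨ z#0 ⟩)) (∣ z ∣² Real.* r)
          λ n → solve 3 (λ a b r → a :* (a :* r) :+ :- (b :* (:- b :* r)) := (a :* a :+ b :* b) :* r) ≡.refl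
            (seq (re z) n) (seq (im z) n) (seq r n))
        (*-inverseʳ ∣ z ∣² z#0)
    , pointwise (im (z * z ⁻¹⟨ z#0 ⟩)) (fromℚ 0ℚ)
        λ n → solve 3 (λ a b r → a :* (:- b :* r) :+ b :* (a :* r) := con 0ℚ) ≡.refl (seq (re z) n) (seq (im z) n) (seq r n)
    where r = ∣ z ∣² Real.⁻¹⟨ z#0 ⟩

  #0⇒≉0 : ∀ z → z #0 → ¬ z ≈ 0#
  #0⇒≉0 z z#0 (p , q) = positive⇒≄0 ∣ z ∣² z#0
    (≃-trans ∣ z ∣² (0ℝ Real.* 0ℝ Real.+ 0ℝ Real.* 0ℝ) 0ℝ
      (+-cong (re z Real.* re z) (0ℝ Real.* 0ℝ) (im z Real.* im z) (0ℝ Real.* 0ℝ)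
        (*-cong (re z) 0ℝ (re z) 0ℝ p p) (*-cong (im z) 0ℝ (im z) 0ℝ q q))
      (pointwise (0ℝ Real.* 0ℝ Real.+ 0ℝ Real.* 0ℝ) 0ℝ λ _ → ≡.refl))
    where 0ℝ = fromℚ 0ℚ

  #⇒≉ : ∀ z w → z # w → ¬ z ≈ w
  #⇒≉ z w z#w z≈w = #0⇒≉0 (z - w) z#w
    (𝕂.trans {z - w} {w - w} {0#} (𝕂.+-congʳ {(- w)} {z} {w} z≈w) (𝕂.-‿inverseʳ w))

  private
    natℚ : ℕ → ℚ
    natℚ zero    = 0ℚ
    natℚ (suc n) = 1ℚ ℚ.+ natℚ n

    seq-fromℕ : ∀ m n → seq (re (fromℕ m)) n ≡ natℚ m
    seq-fromℕ zero    n = ≡.refl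
    seq-fromℕ (suc m) n = ≡.cong (1ℚ ℚ.+_) (seq-fromℕ m n)

    n<1+n : ∀ n → natℚ n ℚ.< natℚ (suc n)
    n<1+n n = ≡.subst (ℚ._< natℚ (suc n)) (ℚ.+-identityˡ (natℚ n)) (ℚ.+-monoˡ-< (natℚ n) (ℚ.positive⁻¹ 1ℚ))

    natℚ-mono-< : ∀ {m n} → m ℕ.<′ n → natℚ m ℚ.< natℚ n
    natℚ-mono-< {m} (ℕ.<′-base)     = n<1+n m
    natℚ-mono-< {m} (ℕ.<′-step {n} m<n) = ℚ.<-trans (natℚ-mono-< m<n) (n<1+n n)

    0<natℚ-natℚ : ∀ {m n} → m ℕ.< n → 0ℚ ℚ.< natℚ n ℚ.- natℚ m
    0<natℚ-natℚ {m} {n} m<n = ≡.subst (ℚ._< natℚ n ℚ.- natℚ m) (ℚ.+-inverseʳ (natℚ m))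
      (ℚ.+-monoˡ-< (ℚ.- natℚ m) (natℚ-mono-< (ℕ.<⇒<′ m<n)))

    -- The real parts are constant sequences at distance `natℚ n - natℚ m`; taking this distance
    -- itself as `ε` refutes their equality.
    fromℕ-<⇒≉ : ∀ {m n} → m ℕ.< n → ¬ fromℕ m ≈ fromℕ n
    fromℕ-<⇒≉ {m} {n} m<n (p , _) with p (natℚ n ℚ.- natℚ m) (0<natℚ-natℚ m<n)
    ... | N , f = ℚ.<-irrefl ≡.refl (begin-strict
      natℚ n ℚ.- natℚ m              ≡⟨ ℚ.0≤p⇒∣p∣≡p (ℚ.<⇒≤ (0<natℚ-natℚ m<n)) ⟨
      ℚ.∣ natℚ n ℚ.- natℚ m ∣        ≡⟨ ℚ.∣-p∣≡∣p∣ (natℚ n ℚ.- natℚ m) ⟨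
      ℚ.∣ ℚ.- (natℚ n ℚ.- natℚ m) ∣  ≡⟨ ≡.cong ℚ.∣_∣ (solve 2 (λ a b → :- (a :- b) := b :- a) ≡.refl (natℚ n) (natℚ m)) ⟩
      ℚ.∣ natℚ m ℚ.- natℚ n ∣        ≡⟨ ≡.cong₂ (λ s t → ℚ.∣ s ℚ.- t ∣) (seq-fromℕ m N) (seq-fromℕ n N) ⟨
      _                              <⟨ f N ℕ.≤-refl ⟩
      natℚ n ℚ.- natℚ m              ∎)
      where open ℚ.≤-Reasoning

  fromℕ-injective : ∀ m n → fromℕ m ≈ fromℕ n → m ≡ n
  fromℕ-injective m n eq with ℕ.<-cmp m n
  ... | tri< m<n _ _ = contradiction eq (fromℕ-<⇒≉ m<n)
  ... | tri≈ _ m≡n _ = m≡n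
  ... | tri> _ _ n<m = contradiction (𝕂.sym {fromℕ m} {fromℕ n} eq) (fromℕ-<⇒≉ n<m)

-- The design

∣α∣>0⇒Nonempty : ∀ {n} (α : Subset n) → 0 ℕ.< ∣ α ∣ → Nonempty α
∣α∣>0⇒Nonempty {n} α 0<∣α∣ with Sub.nonempty? α
... | yes nonempty = nonempty
... | no empty = contradiction (≡.trans (≡.cong ∣_∣ (Sub.Empty-unique empty)) (Sub.∣⊥∣≡0 n)) (ℕ.<⇒≢ 0<∣α∣ ∘ ≡.sym)

trues : ∀ {n} → (Fin n → Bool) → ℕ
trues {zero}  f = 0
trues {suc n} f = (if f zero then 1 else 0) ℕ.+ trues (f ∘ suc)

-- Puts the partition axiom, an equation between complex numbers, into a form to which
-- `fromℕ-injective` applies.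
sum-indicator : ∀ {n} (f : Fin n → Bool) → sum (λ i → if f i then 1# else 0#) ≈ fromℕ (trues f)
sum-indicator {zero}  f = 𝕂.refl {0#}
sum-indicator {suc n} f with f zero
... | true  = 𝕂.+-congˡ {1#} {sum (λ i → if f (suc i) then 1# else 0#)} {fromℕ (trues (f ∘ suc))}
                (sum-indicator (f ∘ suc))
... | false = 𝕂.trans {0# + rest} {rest} {fromℕ (trues (f ∘ suc))}
                (𝕂.+-identityˡ rest) (sum-indicator (f ∘ suc))
  where
  rest : ℂ
  rest = sum (λ i → if f (suc i) then 1# else 0#)

trues-positive : ∀ {n} (f : Fin n → Bool) i → T (f i) → 0 ℕ.< trues f
trues-positive f zero    fi with f zero
... | true = ℕ.z<s
trues-positive f (suc i) fi = ℕ.<-≤-trans (trues-positive (f ∘ suc) i fi) (ℕ.m≤n+m _ (if f zero then 1 else 0))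

module _ {v d} (𝒳 : AssociationScheme v d) where

  open AssociationScheme 𝒳
  open ComplexProperties using (fromℕ-injective)

  private
    1≈fromℕ1 : 1# ≈ fromℕ 1
    1≈fromℕ1 = 𝕂.sym {fromℕ 1} {1#} (𝕂.+-identityʳ 1#)

  -- The entries of the A i at (x , x) sum to 1, which A zero alone attains.
  R-irreflexive : ∀ j {x y} → T (R (suc j) x y) → x ≢ y
  R-irreflexive j {x} Rxx ≡.refl with R zero x x in eq
  ... | true  = contradiction (trues-positive (λ i → R (suc i) x x) j Rxx)
    (ℕ.<-irrefl (≡.sym (ℕ.suc-injective (≡.trans (≡.cong total (≡.sym eq)) one))))
    where
    total : Bool → ℕ
    total b = (if b then 1 else 0) ℕ.+ trues (λ i → R (suc i) x x)
    one : trues (λ i → R i x x) ≡ 1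
    one = fromℕ-injective (trues (λ i → R i x x)) 1
      (𝕂.trans {fromℕ (trues (λ i → R i x x))} {sum (λ i → A i x x)} {fromℕ 1}
        (𝕂.sym {sum (λ i → A i x x)} {fromℕ (trues (λ i → R i x x))} (sum-indicator (λ i → R i x x)))
        (𝕂.trans {sum (λ i → A i x x)} {1#} {fromℕ 1} (partition x x) 1≈fromℕ1))
  -- Here the entry of `A zero` at `(x , x)` would be `0#`, whereas `identity` makes it `1#`.
  ... | false = contradiction (fromℕ-injective 0 1
      (𝕂.trans {0#} {I v x x} {fromℕ 1} (≡.subst (λ b → (if b then 1# else 0#) ≈ I v x x) eq (identity x x))
        (≡.subst (λ b → (if b then 1# else 0#) ≈ fromℕ 1) (≡.sym (dec-true (x Fin.≟ x) ≡.refl)) 1≈fromℕ1))) λ ()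

theorem3p8 : ∀ {v d : ℕ} (𝒳 : AssociationScheme v d) →
    (k : ℕ) → 1 ≤ k →
    (A : Matrix ℂ v v) → Diagonalisable A →
    (a b c : ℂ) →
    D A k ≐ (λ z → z ≈ a ⊎ z ≈ b ⊎ z ≈ c) →
    (a#b : a # b) → a # c → b # c →
    (c₀ c₁ : ℂ) (c₂ : Fin d → ℂ) →
    (∀ α → ∣ α ∣ ≡ 0 → charCoeff A α k ≈ c₀) →
    (∀ α → ∣ α ∣ ≡ 1 → charCoeff A α k ≈ c₁) →
    (∀ j α → AssociationScheme.R̃ 𝒳 (suc j) α → charCoeff A α k ≈ c₂ j) →
    (η₂ : Fin d → ℕ) →
    IsPBIBD 𝒳 k η₂ (ℌ A k c) →
    ∃[ μ ] IsPBIBD 𝒳 k μ (ℌ A k a) ×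
    (∀ j → fromℕ (μ j) ≈
    ((- 1#) ^ k / (a - b) ⟨ a#b ⟩) * (c₀ - fromℕ 2 * c₁ + c₂ j)
    - (b / (a - b) ⟨ a#b ⟩) * fromℕ (binom (+ v -ℤ + 2) (+ k -ℤ + 2))
    - ((c - b) / (a - b) ⟨ a#b ⟩) * fromℕ (η₂ j))
theorem3p8 {v} {d} 𝒳 k 1≤k A _ a b c D≐ a#b a#c b#c c₀ c₁ c₂ coeff₀ coeff₁ coeff₂ η₂ 𝓒 = μ , pbibd , formula
  where
  open AssociationScheme 𝒳 using (R; nonempty)
  module 𝓒 = IsPBIBD 𝓒
  open Counting ℂ-commutativeRing using (module ThreeValues)
  open ThreeValues A k a b c (ComplexProperties.#⇒≉ a b a#b) (ComplexProperties.#⇒≉ a c a#c)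
    (ComplexProperties.#⇒≉ b c b#c)
    -- Each `k`-minor lies in `D A k` as its own value, so the inclusion into the three values tells
    -- which one it is.
    (λ β ∣β∣≡k → proj₁ D≐ {det (A [ β ])} (β , ∣β∣≡k , 𝕂.refl {det (A [ β ])}))

  u : ℂ
  u = (a - b) ⁻¹⟨ a#b ⟩

  inverse : (a - b) * u ≈ 1#
  inverse = ComplexProperties.*-inverse (a - b) a#b

  -- Nonemptiness of the identity relation provides a vertex at which the common degree is read off.
  x₀ : Fin v
  x₀ = proj₁ (nonempty zero)

  star : ∀ z {m} x → HasSize (λ α → HasMinor z α × ⁅ x ⁆ ⊆ α) m → HasSize (λ α → HasMinor z α × x ∈ₛ α) m
  star z x = HasSize-resp-⇔ λ α → ⇔-id _ ×-⇔ ⁅⁆⊆⇔∈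

  star₂ : ∀ z {m} x y →
    HasSize (λ α → HasMinor z α × ⁅ x ⁆ ∪ ⁅ y ⁆ ⊆ α) m → HasSize (λ α → HasMinor z α × x ∈ₛ α × y ∈ₛ α) m
  star₂ z x y = HasSize-resp-⇔ λ α → ⇔-id _ ×-⇔ ⁅⁆∪⁅⁆⊆⇔∈×∈

  #c-⁅⁆ : ∀ x → #c ⁅ x ⁆ ≡ 𝓒.degree
  #c-⁅⁆ x = HasSize-unique (star c x (HasSize-supersets hasC? ⁅ x ⁆)) (𝓒.regular x)

  #c-⁅⁆∪⁅⁆ : ∀ j x y → T (R (suc j) x y) → #c (⁅ x ⁆ ∪ ⁅ y ⁆) ≡ η₂ j
  #c-⁅⁆∪⁅⁆ j x y Rxy = HasSize-unique
    (star₂ c x y (HasSize-supersets hasC? (⁅ x ⁆ ∪ ⁅ y ⁆))) (𝓒.balanced j x y Rxy)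

  #a-⁅⁆ : ∀ x → #a ⁅ x ⁆ ≡ #a ⁅ x₀ ⁆
  #a-⁅⁆ x = ComplexProperties.fromℕ-injective (#a ⁅ x ⁆) (#a ⁅ x₀ ⁆)
    (𝕂.trans {fromℕ (#a ⁅ x ⁆)} {value} {fromℕ (#a ⁅ x₀ ⁆)} (at x) (𝕂.sym {fromℕ (#a ⁅ x₀ ⁆)} {value} (at x₀)))
    where
    value : ℂ
    value = (- 1#) ^ k * u * (c₀ - c₁)
      - b * u * fromℕ (binom (+ v -ℤ + 1) (+ k -ℤ + 1)) - (c - b) * u * fromℕ 𝓒.degree
    at : ∀ x → fromℕ (#a ⁅ x ⁆) ≈ value
    at x = count-⁅⁆ x {c₀} {c₁} {u} inverse (coeff₀ ⊥ (Sub.∣⊥∣≡0 v)) (coeff₁ ⁅ x ⁆ (Sub.∣⁅x⁆∣≡1 x)) (#c-⁅⁆ x)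

  -- Division unfolds to multiplication by `u`, so this is by definition the right-hand side of the
  -- required formula.
  value : Fin d → ℂ
  value j = (- 1#) ^ k * u * (c₀ - fromℕ 2 * c₁ + c₂ j)
    - b * u * fromℕ (binom (+ v -ℤ + 2) (+ k -ℤ + 2)) - (c - b) * u * fromℕ (η₂ j)

  count-pair : ∀ j x y → T (R (suc j) x y) → fromℕ (#a (⁅ x ⁆ ∪ ⁅ y ⁆)) ≈ value j
  -- Irreflexivity of the classes `suc j` makes `⁅ x ⁆ ∪ ⁅ y ⁆` a genuine pair; the `2` in the
  -- binomial coefficient is its size.
  count-pair j x y Rxy = count-⁅⁆∪⁅⁆ x y {c₀} {c₁} {c₂ j} {u} (R-irreflexive 𝒳 j Rxy) inverse
    (coeff₀ ⊥ (Sub.∣⊥∣≡0 v)) (coeff₁ ⁅ x ⁆ (Sub.∣⁅x⁆∣≡1 x)) (coeff₁ ⁅ y ⁆ (Sub.∣⁅x⁆∣≡1 y))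
    (coeff₂ j (⁅ x ⁆ ∪ ⁅ y ⁆) (x , y , Rxy , ≡.refl)) (#c-⁅⁆∪⁅⁆ j x y Rxy)

  -- Counted at the representative pair that `nonempty` supplies; by `count-pair` any other pair of
  -- the class gives the same number.
  μ : Fin d → ℕ
  μ j = let x , y , _ = nonempty (suc j) in #a (⁅ x ⁆ ∪ ⁅ y ⁆)

  formula : ∀ j → fromℕ (μ j) ≈ value j
  formula j = let x , y , Rxy = nonempty (suc j) in count-pair j x y Rxy

  #a-⁅⁆∪⁅⁆ : ∀ j x y → T (R (suc j) x y) → #a (⁅ x ⁆ ∪ ⁅ y ⁆) ≡ μ j
  #a-⁅⁆∪⁅⁆ j x y Rxy = ComplexProperties.fromℕ-injective (#a (⁅ x ⁆ ∪ ⁅ y ⁆)) (μ j)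
    (𝕂.trans {fromℕ (#a (⁅ x ⁆ ∪ ⁅ y ⁆))} {value j} {fromℕ (μ j)} (count-pair j x y Rxy)
      (𝕂.sym {fromℕ (μ j)} {value j} (formula j)))

  degree>0 : 0 ℕ.< #a ⁅ x₀ ⁆
  degree>0 =
    -- The converse inclusion for `D A k` yields a hyperedge `α` with minor `a`. It is nonempty
    -- because `1 ≤ k`, so one of its vertices has positive degree, and all degrees agree.
    let α , ∣α∣≡k , det≈a = proj₂ D≐ {a} (inj₁ (𝕂.refl {a}))
        x , x∈α = ∣α∣>0⇒Nonempty α (≡.subst (1 ≤_) (≡.sym ∣α∣≡k) 1≤k)
    in ≡.subst (0 ℕ.<_) (#a-⁅⁆ x)
         (HasSize-positive ((∣α∣≡k , det≈a) , x∈α) (star a x (HasSize-supersets hasA? ⁅ x ⁆)))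

  pbibd : IsPBIBD 𝒳 k μ (ℌ A k a)
  pbibd = record
    { degree   = #a ⁅ x₀ ⁆
    ; degree>0 = degree>0
    ; regular  = λ x → ≡.subst (HasSize _) (#a-⁅⁆ x) (star a x (HasSize-supersets hasA? ⁅ x ⁆))
    ; balanced = λ j x y Rxy → ≡.subst (HasSize _) (#a-⁅⁆∪⁅⁆ j x y Rxy)
        (star₂ a x y (HasSize-supersets hasA? (⁅ x ⁆ ∪ ⁅ y ⁆)))
    }
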